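{- Let $\lambda$ be a partition, $\pi$ a reverse plane partition of shape $\lambda$, and $\pi=h_1*h_2*\cdots*h_s*0$ (with $s\ge1$) a lexicographic factorisation of $\pi$. Then $h_2*\cdots*h_s*0=\pi-Q(v,\pi)$, where $v$ is the minimum of $\mathrm{cand}(\pi)$ with respect to the content order.
   Context: Cells are pairs $(i,j)\in\mathbb Z^2$; $\mathrm n(i,j)=(i-1,j)$, $\mathrm e(i,j)=(i,j+1)$, $\mathrm s(i,j)=(i+1,j)$, $\mathrm w(i,j)=(i,j-1)$. A partition $\lambda$ is identified with its Young diagram; $\lambda'$ is its conjugate. A reverse plane partition of shape $\lambda$ is $\pi:\lambda\to\mathbb N$ with $\pi(u)\le\pi(\mathrm e u),\pi(\mathrm s u)$, with conventions $\pi(i,j)=0$ if $i\le0$ or $j\le0$, $\pi(i,j)=\infty$ if $i,j\ge1$, $(i,j)\notin\lambda$; $0$ denotes the zero reverse plane partition. Content $c(i,j)=j-i$; outer corner: $u\in\lambda$, $\mathrm e u,\mathrm s u\notin\lambda$; inner corner: $\mathrm e u,\mathrm s u\in\lambda$, $\mathrm e\mathrm s u\notin\lambda$. With inner corner contents $i_1<\dots<i_r$ and outer corner contents $o_1<\dots<o_{r+1}$ (interlacing), $\mathcal I=\{u\in\lambda:c(u)=i_k\}$, $\mathcal O=\{u\in\lambda:c(u)=o_k\}$, $\mathcal A=\{u\in\lambda:c(u)<o_1\text{ or }i_k<c(u)<o_{k+1}\text{ for some }k\in[r]\}$, $\mathcal B=\{u\in\lambda:o_k<c(u)<i_k\text{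 for some }k\in[r]\text{ or }c(u)>o_{r+1}\}$. Content order: $(i,j)\trianglelefteq(k,l)$ iff $j-i>l-k$, or $j-i=l-k$ and $i\ge k$. Candidates: $\mathrm{cand}(\pi)=\{u\in\mathcal O:\pi(u)>\pi(\mathrm w u)\}\cup\{u\in\mathcal A:\pi(u)>\pi(\mathrm w u),\pi(u)>\pi(\mathrm n u)\}$. North-east path: $(u_0,\dots,u_s)$ in $\lambda$, $u_k\in\{\mathrm n u_{k-1},\mathrm e u_{k-1}\}$, length $s$, head $\alpha=u_0$, tail $\omega=u_s$. South-west path: $(v_0,\dots,v_s)$, $v_k\in\{\mathrm s v_{k-1},\mathrm w v_{k-1}\}$, length $s$, $\alpha=v_s$, $\omega=v_0$. Rim-hook: north-east path $h$ with $\mathrm s\alpha(h)\notin\lambda$, $\mathrm e\omega(h)\notin\lambda$, $\mathrm e\mathrm s u\notin\lambda$ for all $u\in h$; for $u=(i,j)\in\lambda$, $h^u$ is the rim-hook from $(\lambda'_j,j)$ to $(i,\lambda_i)$, and these are all rim-hooks. Reverse lexicographic order on cells: $(i,j)\le(k,l)$ iff $j>l$, or $j=l$ and $i\ge k$; rim-hooks ordered by $h^u\le h^v$ iff $u\le v$. $(\pi\pm P)(u)=\pi(u)\pm1$ for $u\in P$, else $\pi(u)$. $(P,\pi)$ compatible: $u\in P\cap(\mathcal I\cup\mathcal A)$ implies $\mathrm e u\in P$ and $\pi(u)=\pi(\mathrm e u)$; $u,\mathrm s u\in P$ implies $\pi(u)=\pi(\mathrm s u)$. $h$ inserts into $\pi$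 if some path $P$ has $\omega(P)=\omega(h)$, $\ell(P)=\ell(h)$, $(P,\pi)$ compatible and $\pi+P$ a reverse plane partition; then $h*\pi=\pi+P(h,\pi)$, with $P(h,\pi)$ the south-west path starting at $\omega(h)$ which, while its length is less than $\ell(h)$, moves from current cell $u$ to $\mathrm s u$ if $u\in\mathcal B\cup\mathcal I$ and $\pi(u)=\pi(\mathrm s u)$, and to $\mathrm w u$ otherwise. Iterated insertion is read right to left. A lexicographic factorisation of $\pi$ is an expression $\pi=h_1*h_2*\cdots*h_s*0$ with rim-hooks $h_1\le h_2\le\dots\le h_s$ (each insertion being defined). For $v\in\mathrm{cand}(\pi)$, $Q(v,\pi)$ is the north-east path starting at $v$ which, from current cell $u$, moves to $\mathrm n u$ if $u\in\mathcal O\cup\mathcal B$ and $\pi(u)=\pi(\mathrm n u)$; to $\mathrm e u$ if $u\in\mathcal I\cup\mathcal A$, or if $\mathrm e u\in\lambda$ and $\pi(u)>\pi(\mathrm n u)$; and terminates if $\pi(u)>\pi(\mathrm n u)$ and $\mathrm e u\notin\lambda$. -}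

module Defs where

open import Data.Nat as ℕ using (ℕ; zero; suc; _≤_; _<_; _≥_; _>_; _<ᵇ_; _∸_)
open import Data.Integer as ℤ using (ℤ; +_)
open import Data.Bool using (Bool; true; false; if_then_else_; _∨_)
open import Data.List using (List; []; _∷_; _++_; reverse; length; filter)
open import Data.List.Relation.Unary.All using (All)
open import Data.List.Relation.Unary.Any using (Any)
open import Data.List.Relation.Unary.Linked using (Linked)
open import Data.List.Membership.Propositional using (_∈_)
open import Data.Maybe using (Maybe; just; nothing)
open import Data.Product using (Σ; _×_; _,_; ∃; ∃-syntax)
open import Data.Sum using (_⊎_)
open import Data.Empty using (⊥)
open import Relation.Nullary using (¬_; does)
open import Relation.Binary.PropositionalEquality using (_≡_)

record Partition : Set where
  constructor mkPartition
  field
    parts    : List ℕ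
    decr     : Linked _≥_ parts
    positive : All (1 ≤_) parts
open Partition public

-- Cells (i , j).  All cells that ever matter (cells of λ and their
-- n / e / s / w neighbours) have non-negative coordinates, so we use ℕ × ℕ.
Cell : Set
Cell = ℕ × ℕ

nC eC sC wC : Cell → Cell
nC (i , j) = (i ∸ 1 , j)     -- only applied to cells of λ, where i ≥ 1
eC (i , j) = (i , suc j)
sC (i , j) = (suc i , j)
wC (i , j) = (i , j ∸ 1)     -- only applied to cells of λ, where j ≥ 1

-- Row lengths, 1-indexed: row λ i = λᵢ (and 0 for i = 0 or i > ℓ(λ)).
rowL : List ℕ → ℕ → ℕ
rowL _ zero = 0
rowL [] (suc i) = 0
rowL (x ∷ xs) (suc zero) = x
rowL (x ∷ xs) (suc (suc i)) = rowL xs (suc i)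

row : Partition → ℕ → ℕ
row λp i = rowL (parts λp) i

col : Partition → ℕ → ℕ
col λp j = length (filter (λ x → j ℕ.≤? x) (parts λp))

_∈λ_ : Cell → Partition → Set
(i , j) ∈λ λp = 1 ≤ j × j ≤ row λp i

_∉λ_ : Cell → Partition → Set
u ∉λ λp = ¬ (u ∈λ λp)

content : Cell → ℤ
content (i , j) = (+ j) ℤ.- (+ i)

OuterCorner : Partition → Cell → Set
OuterCorner λp u = u ∈λ λp × eC u ∉λ λp × sC u ∉λ λp

InnerCorner : Partition → Cell → Set
InnerCorner λp u = eC u ∈λ λp × sC u ∈λ λp × eC (sC u) ∉λ λp

-- Contents of the outer corners, listed by increasing row index i
-- (hence by strictly decreasing content).  Row i (with λᵢ ≥ 1) has an
-- outer corner (i , λᵢ) iff λᵢ₊₁ < λᵢ.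
outerContentsFrom : ℕ → List ℕ → List ℤ
outerContentsFrom i [] = []
outerContentsFrom i (x ∷ []) = ((+ x) ℤ.- (+ i)) ∷ []
outerContentsFrom i (x ∷ y ∷ ys) =
  (if y <ᵇ x then ((+ x) ℤ.- (+ i)) ∷ [] else []) ++ outerContentsFrom (suc i) (y ∷ ys)

-- Contents of the inner corners, by increasing row index.  Row i has an
-- inner corner (i , λᵢ₊₁) iff 1 ≤ λᵢ₊₁ < λᵢ.
innerContentsFrom : ℕ → List ℕ → List ℤ
innerContentsFrom i [] = []
innerContentsFrom i (x ∷ []) = []
innerContentsFrom i (x ∷ y ∷ ys) =
  (if y <ᵇ x then ((+ y) ℤ.- (+ i)) ∷ [] else []) ++ innerContentsFrom (suc i) (y ∷ ys)

-- o₁ < o₂ < … < o_{r+1}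
outerContents : Partition → List ℤ
outerContents λp = reverse (outerContentsFrom 1 (parts λp))

-- i₁ < i₂ < … < i_r
innerContents : Partition → List ℤ
innerContents λp = reverse (innerContentsFrom 1 (parts λp))

nth : {A : Set} → List A → ℕ → Maybe A
nth [] _ = nothing
nth (x ∷ xs) zero = just x
nth (x ∷ xs) (suc k) = nth xs k

inI : Partition → Cell → Set
inI λp u = u ∈λ λp × content u ∈ innerContents λp

inO : Partition → Cell → Set
inO λp u = u ∈λ λp × content u ∈ outerContents λp

-- 𝓐 = {u ∈ λ : c(u) < o₁, or i_k < c(u) < o_{k+1} for some k ∈ [r]}
-- (with 0-indexed lists: o₁ = nth os 0, i_k = nth is (k-1), o_{k+1} = nth os k)
inA : Partition → Cell → Set
inA λp u = u ∈λ λp ×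
  ( (Σ ℤ λ o → nth (outerContents λp) 0 ≡ just o × content u ℤ.< o)
  ⊎ (Σ ℕ λ k → Σ ℤ λ a → Σ ℤ λ b →
       nth (innerContents λp) k ≡ just a × nth (outerContents λp) (suc k) ≡ just b ×
       a ℤ.< content u × content u ℤ.< b) )

inB : Partition → Cell → Set
inB λp u = u ∈λ λp ×
  ( (Σ ℕ λ k → Σ ℤ λ a → Σ ℤ λ b →
       nth (outerContents λp) k ≡ just a × nth (innerContents λp) k ≡ just b ×
       a ℤ.< content u × content u ℤ.< b)
  ⊎ (Σ ℤ λ o → nth (outerContents λp) (length (innerContents λp)) ≡ just o × o ℤ.< content u) )

data ℕ∞ : Set where
  fin : ℕ → ℕ∞
  ∞   : ℕ∞

data _≤∞_ : ℕ∞ → ℕ∞ → Set where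
  fin≤fin : ∀ {m n} → m ≤ n → fin m ≤∞ fin n
  _≤∞∞    : ∀ x → x ≤∞ ∞

data _<∞_ : ℕ∞ → ℕ∞ → Set where
  fin<fin : ∀ {m n} → m < n → fin m <∞ fin n
  fin<∞   : ∀ {m} → fin m <∞ ∞

-- A filling is a function on cells; only its values on λ matter.
Filling : Set
Filling = Cell → ℕ

at : Partition → Filling → Cell → ℕ∞
at λp π (zero , j) = fin 0
at λp π (suc i , zero) = fin 0
at λp π (suc i , suc j) with suc j ℕ.≤? row λp (suc i)
... | Relation.Nullary.yes _ = fin (π (suc i , suc j))
... | Relation.Nullary.no _  = ∞

IsRPP : Partition → Filling → Set
IsRPP λp π = ∀ u → u ∈λ λp →
  (at λp π u ≤∞ at λp π (eC u)) × (at λp π u ≤∞ at λp π (sC u))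

_≈[_]_ : Filling → Partition → Filling → Set
π ≈[ λp ] σ = ∀ u → u ∈λ λp → π u ≡ σ u

zeroF : Filling
zeroF _ = 0

_≟C_ : (u v : Cell) → Relation.Nullary.Dec (u ≡ v)
_≟C_ = Data.Product.Properties.≡-dec ℕ._≟_ ℕ._≟_
  where import Data.Product.Properties

memC : Cell → List Cell → Bool
memC u [] = false
memC u (v ∷ P) = does (u ≟C v) ∨ memC u P

_+P_ : Filling → List Cell → Filling
(π +P P) u = if memC u P then suc (π u) else π u

_-P_ : Filling → List Cell → Filling
(π -P P) u = if memC u P then π u ∸ 1 else π u

-- South-west path (v₀ , … , v_s) in λ, listed from v₀ = ω to v_s = α,
-- with v_k ∈ {s v_{k-1}, w v_{k-1}}.
data SWPath (λp : Partition) : List Cell → Set where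
  one  : ∀ {u} → u ∈λ λp → SWPath λp (u ∷ [])
  step : ∀ {u v P} → u ∈λ λp → (v ≡ sC u ⊎ v ≡ wC u) →
         SWPath λp (v ∷ P) → SWPath λp (u ∷ v ∷ P)

pathLength : List Cell → ℕ
pathLength P = length P ∸ 1

Compatible : Partition → List Cell → Filling → Set
Compatible λp P π =
  (∀ u → u ∈ P → (inI λp u ⊎ inA λp u) → (eC u ∈ P × π u ≡ π (eC u)))
  × (∀ u → u ∈ P → sC u ∈ P → π u ≡ π (sC u))

-- Rim-hooks, indexed by cells u = (i , j) ∈ λ:
-- h^u is the rim-hook from (λ'_j , j) to (i , λᵢ).

hookTail : Partition → Cell → Cell
hookTail λp (i , j) = (i , row λp i)

hookLength : Partition → Cell → ℕ
hookLength λp (i , j) = (col λp j ∸ i) ℕ.+ (row λp i ∸ j)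

_≤rl_ : Cell → Cell → Set
(i , j) ≤rl (k , l) = (j > l) ⊎ (j ≡ l × i ≥ k)

Inserts : Partition → Cell → Filling → Set
Inserts λp h π = Σ (List Cell) λ P →
  SWPath λp P × Data.List.head P ≡ just (hookTail λp h) ×
  pathLength P ≡ hookLength λp h × Compatible λp P π × IsRPP λp (π +P P)

data InsPath (λp : Partition) (π : Filling) : ℕ → Cell → List Cell → Set where
  done  : ∀ {u} → u ∈λ λp → InsPath λp π 0 u (u ∷ [])
  south : ∀ {k u P} → u ∈λ λp → (inB λp u ⊎ inI λp u) →
          at λp π u ≡ at λp π (sC u) →
          InsPath λp π k (sC u) P → InsPath λp π (suc k) u (u ∷ P)
  west  : ∀ {k u P} → u ∈λ λp →
          ¬ ((inB λp u ⊎ inI λp u) × at λp π u ≡ at λp π (sC u)) →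
          InsPath λp π k (wC u) P → InsPath λp π (suc k) u (u ∷ P)

IsInsertionPath : Partition → Cell → Filling → List Cell → Set
IsInsertionPath λp h π P = InsPath λp π (hookLength λp h) (hookTail λp h) P

-- HookFact λ hs π : π = h₁ * h₂ * ⋯ * h_s * 0  (hs = h₁ ∷ … ∷ h_s, every
-- insertion being defined), where h * σ = σ + P(h , σ).
data HookFact (λp : Partition) : List Cell → Filling → Set where
  nil  : ∀ {π} → π ≈[ λp ] zeroF → HookFact λp [] π
  cons : ∀ {h hs σ π P} → h ∈λ λp → HookFact λp hs σ → Inserts λp h σ →
         IsInsertionPath λp h σ P → π ≈[ λp ] (σ +P P) →
         HookFact λp (h ∷ hs) π

LexFact : Partition → List Cell → Filling → Set
LexFact λp hs π = HookFact λp hs π × Linked _≤rl_ hs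

_⊴_ : Cell → Cell → Set
u ⊴ v = (content v ℤ.< content u) ⊎ (content u ≡ content v × Data.Product.proj₁ u ≥ Data.Product.proj₁ v)

Cand : Partition → Filling → Cell → Set
Cand λp π u =
  (inO λp u × at λp π (wC u) <∞ at λp π u)
  ⊎ (inA λp u × at λp π (wC u) <∞ at λp π u × at λp π (nC u) <∞ at λp π u)

IsMinCand : Partition → Filling → Cell → Set
IsMinCand λp π v = Cand λp π v × (∀ u → Cand λp π u → v ⊴ u)

data IsQ (λp : Partition) (π : Filling) : Cell → List Cell → Set where
  north : ∀ {u Q} → u ∈λ λp → (inO λp u ⊎ inB λp u) →
          at λp π u ≡ at λp π (nC u) →
          IsQ λp π (nC u) Q → IsQ λp π u (u ∷ Q)
  east  : ∀ {u Q} → u ∈λ λp →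
          ((inI λp u ⊎ inA λp u) ⊎ (eC u ∈λ λp × at λp π (nC u) <∞ at λp π u)) →
          IsQ λp π (eC u) Q → IsQ λp π u (u ∷ Q)
  stop  : ∀ {u} → u ∈λ λp → at λp π (nC u) <∞ at λp π u → eC u ∉λ λp →
          IsQ λp π u (u ∷ [])

{-# OPTIONS --safe #-}
-- Let π = σ + P with P = P(h₁ , σ).  A path meets every diagonal at most once, and
-- this together with compatibility determines P; so P is compatible with σ.
-- Every candidate of π is then either the head α(P) or a candidate of σ: at any other
-- cell u ∈ P of 𝓞 ∪ 𝓐 the path leaves west, into a cell of 𝓘 ∪ 𝓐, and compatibility
-- gives π (w u) = π u.  As h₁ ≤ h₂, either α(P) has larger content than the head of the
-- path of h₂, or the contents agree and P stays weakly south-east of that path on every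
-- diagonal they share; by induction α(P) precedes all candidates of σ.
-- Finally Q(α(P) , π) retraces P: where P came from the east, n u ∉ P forces π (n u) < π u.
module Submission where

open import Defs
open import Algebra.Properties.AbelianGroup using (∙-cancelˡ; ∙-cancelʳ)
open import Data.Nat as ℕ using (ℕ; zero; suc; _∸_; z≤n; s≤s; s≤s⁻¹)
import Data.Nat.Properties as ℕₚ
open import Data.Integer as ℤ using (ℤ; +_)
import Data.Integer.Properties as ℤₚ
open import Data.Integer.Tactic.RingSolver using (solve-∀)
open import Data.Bool using (true; false)
open import Data.List using (List; []; _∷_; _∷ʳ_; reverse; reverseAcc; length; filter)
open import Data.List.Properties using (unfold-reverse; length-reverse; filter-accept; filter-reject)
open import Data.List.Relation.Unary.Any using (here; there)
import Data.List.Relation.Unary.Any.Properties as Any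
open import Data.List.Relation.Unary.Linked using (Linked; []; [-]; _∷_)
open import Data.List.Membership.Propositional using (_∈_; _∉_)
open import Data.List.Membership.DecPropositional _≟C_ using (_∈?_)
open import Data.Maybe using (just)
open import Data.Maybe.Properties using (just-injective)
open import Data.Product using (Σ; _×_; _,_; proj₁; proj₂)
open import Data.Sum using (_⊎_; inj₁; inj₂; [_,_]′)
open import Function using (_∘_)
open import Relation.Nullary using (¬_; yes; no; contradiction)
open import Relation.Binary.PropositionalEquality

-- Indexing into a list extended at its end.

nth-∷ʳ⁻ : ∀ {A : Set} (xs : List A) {x y} k → nth (xs ∷ʳ x) k ≡ just y →
          nth xs k ≡ just y ⊎ (k ≡ length xs × x ≡ y)
nth-∷ʳ⁻ []       zero    eq = inj₂ (refl , just-injective eq)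
nth-∷ʳ⁻ (z ∷ xs) zero    eq = inj₁ eq
nth-∷ʳ⁻ (z ∷ xs) (suc k) eq with nth-∷ʳ⁻ xs k eq
... | inj₁ old           = inj₁ old
... | inj₂ (refl , x≡y)  = inj₂ (refl , x≡y)

nth-∷ʳ⁺ : ∀ {A : Set} (xs : List A) {x y} k → nth xs k ≡ just y → nth (xs ∷ʳ x) k ≡ just y
nth-∷ʳ⁺ (z ∷ xs) zero    eq = eq
nth-∷ʳ⁺ (z ∷ xs) (suc k) eq = nth-∷ʳ⁺ xs k eq

nth-∷ʳ-length : ∀ {A : Set} (xs : List A) {x} → nth (xs ∷ʳ x) (length xs) ≡ just x
nth-∷ʳ-length []       = refl
nth-∷ʳ-length (_ ∷ xs) = nth-∷ʳ-length xs

nth⇒<length : ∀ {A : Set} (xs : List A) {y} k → nth xs k ≡ just y → k ℕ.< length xs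
nth⇒<length (_ ∷ xs) zero    eq = s≤s z≤n
nth⇒<length (_ ∷ xs) (suc k) eq = s≤s (nth⇒<length xs k eq)

-- Interlacing corner contents and the intervals that define 𝓐 and 𝓑.

-- os and is are the contents of the outer and inner corners in decreasing
-- order, that is, reversed with respect to the numbering oₖ, iₖ.

data Interlaced : List ℤ → List ℤ → Set where
  single : ∀ {o} → Interlaced (o ∷ []) []
  extend : ∀ {o o′ i os is} → i ℤ.< o → o′ ℤ.< i →
           Interlaced (o′ ∷ os) is → Interlaced (o ∷ o′ ∷ os) (i ∷ is)

interlaced-length : ∀ {os is} → Interlaced os is → length os ≡ suc (length is)
interlaced-length single         = refl
interlaced-length (extend _ _ il) = cong suc (interlaced-length il)

reverse-length : ∀ {os is} → Interlaced os is → length (reverse os) ≡ suc (length (reverse is))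
reverse-length {os} {is} il =
  trans (length-reverse os) (trans (interlaced-length il) (cong suc (sym (length-reverse is))))

reverse-tail-length : ∀ {o os is} → Interlaced (o ∷ os) is → length (reverse os) ≡ length (reverse is)
reverse-tail-length {os = os} {is} il =
  trans (length-reverse os) (trans (ℕₚ.suc-injective (interlaced-length il)) (sym (length-reverse is)))

InA InB : ℤ → List ℤ → List ℤ → Set
InA c os is =
    (Σ ℤ λ o → nth os 0 ≡ just o × c ℤ.< o)
  ⊎ (Σ ℕ λ k → Σ ℤ λ a → Σ ℤ λ b → nth is k ≡ just a × nth os (suc k) ≡ just b × a ℤ.< c × c ℤ.< b)
InB c os is =
    (Σ ℕ λ k → Σ ℤ λ a → Σ ℤ λ b → nth os k ≡ just a × nth is k ≡ just b × a ℤ.< c × c ℤ.< b)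
  ⊎ (Σ ℤ λ o → nth os (length is) ≡ just o × o ℤ.< c)

-- Recursive form of `InA` on the decreasing lists, whose heads are o_{r+1} and i_r: `last` is c <
-- o₁ and `here` is i_k < c < o_{k+1}. It follows the order in which the rows produce the corners.
data DecrA (c : ℤ) : List ℤ → List ℤ → Set where
  last  : ∀ {o} → c ℤ.< o → DecrA c (o ∷ []) []
  here  : ∀ {o os i is} → i ℤ.< c → c ℤ.< o → DecrA c (o ∷ os) (i ∷ is)
  there : ∀ {o os i is} → DecrA c os is → DecrA c (o ∷ os) (i ∷ is)

data DecrB (c : ℤ) : List ℤ → List ℤ → Set where
  here  : ∀ {o o′ os i is} → o′ ℤ.< c → c ℤ.< i → DecrB c (o ∷ o′ ∷ os) (i ∷ is)
  there : ∀ {o os i is} → DecrB c os is → DecrB c (o ∷ os) (i ∷ is)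

-- The unbounded interval c > o_{r+1} of 𝓑. It is kept apart from `DecrB` because a further outer
-- corner in front turns it into a bounded interval.
data HeadBelow (c : ℤ) : List ℤ → Set where
  headBelow : ∀ {o os} → o ℤ.< c → HeadBelow c (o ∷ os)

decrA⇒InA : ∀ {c os is} → Interlaced os is → DecrA c os is → InA c (reverse os) (reverse is)
decrA⇒InA single (last c<o) = inj₁ (_ , refl , c<o)
decrA⇒InA {c} {o ∷ os@(_ ∷ _)} {i ∷ is} (extend _ _ il) a
  rewrite unfold-reverse o os | unfold-reverse i is = go a
  where
  go : DecrA c (o ∷ os) (i ∷ is) → InA c (reverse os ∷ʳ o) (reverse is ∷ʳ i)
  -- Reversal sends both heads to the last positions, and `reverse os` is one longer than
  -- `reverse is`, so the two indices differ by one as `InA` demands.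
  go (here i<c c<o) = inj₂ (length (reverse is) , i , o , nth-∷ʳ-length (reverse is) ,
    subst (λ k → nth (reverse os ∷ʳ o) k ≡ just o) (reverse-length il) (nth-∷ʳ-length (reverse os)) , i<c , c<o)
  go (there a′) with decrA⇒InA il a′
  ... | inj₁ (o₁ , eq , lt)               = inj₁ (o₁ , nth-∷ʳ⁺ (reverse os) 0 eq , lt)
  ... | inj₂ (k , x , y , eqi , eqo , lt) =
    inj₂ (k , x , y , nth-∷ʳ⁺ (reverse is) k eqi , nth-∷ʳ⁺ (reverse os) (suc k) eqo , lt)

headBelow⇒InB : ∀ {c os is} → Interlaced os is → HeadBelow c os → InB c (reverse os) (reverse is)
headBelow⇒InB {c} {o ∷ os} {is} il (headBelow o<c) rewrite unfold-reverse o os =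
  inj₂ (o , subst (λ k → nth (reverse os ∷ʳ o) k ≡ just o) (reverse-tail-length il) (nth-∷ʳ-length (reverse os)) , o<c)

decrB⇒InB : ∀ {c os is} → Interlaced os is → DecrB c os is →
            Σ ℕ λ k → Σ ℤ λ a → Σ ℤ λ b → nth (reverse os) k ≡ just a × nth (reverse is) k ≡ just b × a ℤ.< c × c ℤ.< b
decrB⇒InB {c} {o ∷ os@(o′ ∷ os′)} {i ∷ is} (extend _ _ il) b
  rewrite unfold-reverse o os | unfold-reverse i is = go b
  where
  go : DecrB c (o ∷ os) (i ∷ is) →
       Σ ℕ λ k → Σ ℤ λ a → Σ ℤ λ b → nth (reverse os ∷ʳ o) k ≡ just a × nth (reverse is ∷ʳ i) k ≡ just b × a ℤ.< c × c ℤ.< b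
  go (here o′<c c<i) = length (reverse is) , o′ , i ,
    nth-∷ʳ⁺ (reverse os) (length (reverse is))
      (subst₂ (λ xs k → nth xs k ≡ just o′) (sym (unfold-reverse o′ os′)) (reverse-tail-length il) (nth-∷ʳ-length (reverse os′))) ,
    nth-∷ʳ-length (reverse is) , o′<c , c<i
  go (there b′) with decrB⇒InB il b′
  ... | k , x , y , eqo , eqi , lt =
    k , x , y , nth-∷ʳ⁺ (reverse os) k eqo , nth-∷ʳ⁺ (reverse is) k eqi , lt

-- Disjointness of 𝓞 ∪ 𝓐 and 𝓑 ∪ 𝓘.

data DecrOA (c : ℤ) : List ℤ → List ℤ → Set where
  last  : ∀ {o} → c ℤ.≤ o → DecrOA c (o ∷ []) []
  here  : ∀ {o os i is} → i ℤ.< c → c ℤ.≤ o → DecrOA c (o ∷ os) (i ∷ is)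
  there : ∀ {o os i is} → DecrOA c os is → DecrOA c (o ∷ os) (i ∷ is)

-- Admitting the corner content as upper end point gives the half-open intervals (i_k, o_{k+1}] in
-- `DecrOA` and (o_k, i_k] here, which alternate by interlacing. The range c > o_{r+1} stays with
-- `HeadBelow`.
data DecrBI (c : ℤ) : List ℤ → List ℤ → Set where
  here  : ∀ {o o′ os i is} → o′ ℤ.< c → c ℤ.≤ i → DecrBI c (o ∷ o′ ∷ os) (i ∷ is)
  there : ∀ {o os i is} → DecrBI c os is → DecrBI c (o ∷ os) (i ∷ is)

O⇒DecrOA : ∀ {c os is} → Interlaced os is → c ∈ os → DecrOA c os is
O⇒DecrOA single           (here refl) = last ℤₚ.≤-refl
O⇒DecrOA (extend i<o _ _)  (here refl) = here i<o ℤₚ.≤-refl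
O⇒DecrOA (extend _ _ il)   (there m)   = there (O⇒DecrOA il m)

I⇒DecrBI : ∀ {c os is} → Interlaced os is → c ∈ is → DecrBI c os is
I⇒DecrBI (extend _ o′<i _) (here refl) = here o′<i ℤₚ.≤-refl
I⇒DecrBI (extend _ _ il)   (there m)   = there (I⇒DecrBI il m)

InA⇒DecrOA : ∀ {c os is} → Interlaced os is → InA c (reverse os) (reverse is) → DecrOA c os is
InA⇒DecrOA single (inj₁ (_ , refl , c<o)) = last (ℤₚ.<⇒≤ c<o)
InA⇒DecrOA {c} {o ∷ os@(_ ∷ _)} {i ∷ is} (extend _ _ il) a
  rewrite unfold-reverse o os | unfold-reverse i is = go a
  where
  go : InA c (reverse os ∷ʳ o) (reverse is ∷ʳ i) → DecrOA c (o ∷ os) (i ∷ is)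
  go (inj₁ (o₁ , eq , lt)) with nth-∷ʳ⁻ (reverse os) 0 eq
  ... | inj₁ old       = there (InA⇒DecrOA il (inj₁ (o₁ , old , lt)))
  -- The reversed tail is nonempty, so position 0 cannot be that of the new head.
  ... | inj₂ (eq₀ , _) = contradiction (trans eq₀ (reverse-length il)) λ ()
  go (inj₂ (k , x , y , eqi , eqo , x<c , c<y))
    with nth-∷ʳ⁻ (reverse is) k eqi | nth-∷ʳ⁻ (reverse os) (suc k) eqo
  ... | inj₁ oi | inj₁ oo = there (InA⇒DecrOA il (inj₂ (k , x , y , oi , oo , x<c , c<y)))
  ... | inj₂ (_ , refl) | inj₂ (_ , refl) = here x<c (ℤₚ.<⇒≤ c<y)
  ... | inj₁ oi | inj₂ (k≡ , _) =
    contradiction (nth⇒<length (reverse is) k oi) (ℕₚ.<-irrefl (ℕₚ.suc-injective (trans k≡ (reverse-length il))))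
  ... | inj₂ (k≡ , _) | inj₁ oo =
    contradiction (nth⇒<length (reverse os) (suc k) oo) (ℕₚ.<-irrefl (trans (cong suc k≡) (sym (reverse-length il))))

InB⇒HeadBelow : ∀ {c o os is} → Interlaced os is → nth (reverse os) (length (reverse is)) ≡ just o →
                o ℤ.< c → HeadBelow c os
InB⇒HeadBelow {os = o ∷ os} {is} il eq o<c rewrite unfold-reverse o os
  with nth-∷ʳ⁻ (reverse os) (length (reverse is)) eq
... | inj₂ (_ , refl) = headBelow o<c
... | inj₁ old = contradiction (nth⇒<length (reverse os) _ old) (ℕₚ.<-irrefl (sym (reverse-tail-length il)))

InB⇒DecrBI : ∀ {c os is k x y} → Interlaced os is → nth (reverse os) k ≡ just x → nth (reverse is) k ≡ just y →
             x ℤ.< c → c ℤ.< y → DecrBI c os is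
InB⇒DecrBI {c} {o ∷ o′ ∷ os} {i ∷ is} {k} (extend _ _ il) eqo eqi x<c c<y
  rewrite unfold-reverse o (o′ ∷ os) | unfold-reverse i is
  with nth-∷ʳ⁻ (reverse (o′ ∷ os)) k eqo | nth-∷ʳ⁻ (reverse is) k eqi
... | inj₁ oo | inj₁ oi = there (InB⇒DecrBI il oo oi x<c c<y)
... | inj₂ (k≡ , _) | inj₁ oi =
  contradiction (nth⇒<length (reverse is) k oi)
    (ℕₚ.≤⇒≯ (subst (length (reverse is) ℕ.≤_) (sym (trans k≡ (reverse-length il))) (ℕₚ.n≤1+n _)))
... | inj₂ (k≡ , _) | inj₂ (k≡′ , _) = contradiction (trans (sym k≡′) (trans k≡ (reverse-length il))) (ℕₚ.<⇒≢ (ℕₚ.n<1+n _))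
-- Here the inner content found is the head `i`, so `k` is the length of the tail `is`, and the
-- outer content at that index is the second head `o′`.
... | inj₁ oo | inj₂ (k≡ , refl) rewrite unfold-reverse o′ os with nth-∷ʳ⁻ (reverse os) k oo
...   | inj₂ (_ , refl) = here x<c (ℤₚ.<⇒≤ c<y)
...   | inj₁ old = contradiction (nth⇒<length (reverse os) k old) (ℕₚ.<-irrefl (trans k≡ (sym (reverse-tail-length il))))

decrOA⇒≤head : ∀ {c o os is} → Interlaced (o ∷ os) is → DecrOA c (o ∷ os) is → c ℤ.≤ o
decrOA⇒≤head _ (last c≤o)   = c≤o
decrOA⇒≤head _ (here _ c≤o) = c≤o
decrOA⇒≤head (extend i<o o′<i il) (there oa) =
  ℤₚ.≤-trans (decrOA⇒≤head il oa) (ℤₚ.<⇒≤ (ℤₚ.<-trans o′<i i<o))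

decrBI⇒<head : ∀ {c o os is} → Interlaced (o ∷ os) is → DecrBI c (o ∷ os) is → c ℤ.< o
decrBI⇒<head (extend i<o _ _) (here _ c≤i) = ℤₚ.≤-<-trans c≤i i<o
decrBI⇒<head (extend i<o o′<i il) (there bi) =
  ℤₚ.<-trans (decrBI⇒<head il bi) (ℤₚ.<-trans o′<i i<o)

OA∩HeadBelow : ∀ {c os is} → Interlaced os is → DecrOA c os is → ¬ HeadBelow c os
OA∩HeadBelow il oa (headBelow o<c) = ℤₚ.≤⇒≯ (decrOA⇒≤head il oa) o<c

OA∩BI : ∀ {c os is} → Interlaced os is → DecrOA c os is → ¬ DecrBI c os is
OA∩BI (extend _ _ _)     (here i<c _) (here _ c≤i)    = ℤₚ.≤⇒≯ c≤i i<c
OA∩BI (extend _ o′<i il) (here i<c _) (there bi)      = ℤₚ.<-asym i<c (ℤₚ.<-trans (decrBI⇒<head il bi) o′<i)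
OA∩BI (extend _ _ il)    (there oa)   (here o′<c _)   = ℤₚ.≤⇒≯ (decrOA⇒≤head il oa) o′<c
OA∩BI (extend _ _ il)    (there oa)   (there bi)      = OA∩BI il oa bi

-- Corners read off from the row lengths.

data Corners (i : ℕ) : List ℕ → List ℤ → List ℤ → Set where
  last : ∀ {x} → Corners i (x ∷ []) ((+ x) ℤ.- (+ i) ∷ []) []
  drop : ∀ {x y ys os is} → y ℕ.< x → Corners (suc i) (y ∷ ys) os is →
         Corners i (x ∷ y ∷ ys) ((+ x) ℤ.- (+ i) ∷ os) ((+ y) ℤ.- (+ i) ∷ is)
  keep : ∀ {x ys os is} → Corners (suc i) (x ∷ ys) os is → Corners i (x ∷ x ∷ ys) os is

<ᵇ-irrefl : ∀ x → (x ℕ.<ᵇ x) ≡ false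
<ᵇ-irrefl zero    = refl
<ᵇ-irrefl (suc x) = <ᵇ-irrefl x

<⇒<ᵇ≡true : ∀ {m n} → m ℕ.< n → (m ℕ.<ᵇ n) ≡ true
<⇒<ᵇ≡true {zero}  {suc n} _         = refl
<⇒<ᵇ≡true {suc m} {suc n} (s≤s m<n) = <⇒<ᵇ≡true m<n

-- Replaces the Boolean tests in the two content lists by a relation with one constructor for each
-- outcome of comparing consecutive rows, so that later proofs recurse on the rows.
corners : ∀ i x xs → Linked ℕ._≥_ (x ∷ xs) →
          Corners i (x ∷ xs) (outerContentsFrom i (x ∷ xs)) (innerContentsFrom i (x ∷ xs))
corners i x []       _          = last
corners i x (y ∷ ys) (y≤x ∷ l) with ℕₚ.m≤n⇒m<n∨m≡n y≤x
... | inj₁ y<x  rewrite <⇒<ᵇ≡true y<x = drop y<x (corners (suc i) y ys l)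
... | inj₂ refl rewrite <ᵇ-irrefl y   = keep (corners (suc i) y ys l)

content-mono-< : ∀ {b y i n} → b ℕ.≤ y → i ℕ.< n → (+ b) ℤ.- (+ n) ℤ.< (+ y) ℤ.- (+ i)
content-mono-< b≤y i<n = ℤₚ.+-mono-≤-< (ℤ.+≤+ b≤y) (ℤₚ.neg-mono-< (ℤ.+<+ i<n))

content-monoˡ-< : ∀ {b y} i → b ℕ.< y → (+ b) ℤ.- (+ i) ℤ.< (+ y) ℤ.- (+ i)
content-monoˡ-< i b<y = ℤₚ.+-monoˡ-< (ℤ.- (+ i)) (ℤ.+<+ b<y)

-- The first outer corner closes the block of rows of length `x`; it lies in column `x`, in row `i`
-- or below.
corners-head : ∀ {i x xs os is} → Corners i (x ∷ xs) os is →
               Σ ℤ λ o → Σ (List ℤ) λ os′ → os ≡ o ∷ os′ × o ℤ.≤ (+ x) ℤ.- (+ i)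
corners-head last       = _ , _ , refl , ℤₚ.≤-refl
corners-head (drop _ _) = _ , _ , refl , ℤₚ.≤-refl
corners-head (keep {x = x} c) with corners-head c
... | o , os′ , eq , o≤ =
  o , os′ , eq , ℤₚ.<⇒≤ (ℤₚ.≤-<-trans o≤ (content-mono-< (ℕₚ.≤-refl {x}) (ℕₚ.n<1+n _)))

corners⇒interlaced : ∀ {i xs os is} → Corners i xs os is → Interlaced os is
corners⇒interlaced last = single
corners⇒interlaced (keep c) = corners⇒interlaced c
corners⇒interlaced {i} (drop {y = y} y<x c) with corners-head c | corners⇒interlaced c
... | o , os′ , refl , o≤ | il =
  extend (content-monoˡ-< i y<x) (ℤₚ.≤-<-trans o≤ (content-mono-< (ℕₚ.≤-refl {y}) (ℕₚ.n<1+n _))) il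

corners-row≤head : ∀ {i x xs os is} → Corners i (x ∷ xs) os is → ∀ m → rowL (x ∷ xs) (suc m) ℕ.≤ x
corners-row≤head _            zero    = ℕₚ.≤-refl
corners-row≤head last         (suc m) = z≤n
corners-row≤head (drop y<x c) (suc m) = ℕₚ.≤-trans (corners-row≤head c m) (ℕₚ.<⇒≤ y<x)
corners-row≤head (keep c)     (suc m) = corners-row≤head c m

-- The class of a rim cell is decided by its east and south neighbours: neither lies in λ for O,
-- both for I, only the east one for A, only the south one for B. The inequalities record these
-- memberships.
data RimKind (PO PI PA PB : Set) (b row row↓ : ℕ) : Set where
  O : PO → row ℕ.≤ b → row↓ ℕ.< b → RimKind PO PI PA PB b row row↓
  I : PI → b ℕ.< row → b ℕ.≤ row↓ → RimKind PO PI PA PB b row row↓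
  A : PA → b ℕ.< row → row↓ ℕ.< b → RimKind PO PI PA PB b row row↓
  B : PB → row ℕ.≤ b → b ℕ.≤ row↓ → RimKind PO PI PA PB b row row↓

rimKind : ∀ {i xs os is c} → Corners i xs os is → ∀ m b → 1 ℕ.≤ b →
          b ℕ.≤ rowL xs (suc m) → rowL xs (suc (suc m)) ℕ.≤ b → c ≡ (+ b) ℤ.- (+ (m ℕ.+ i)) →
          RimKind (c ∈ os) (c ∈ is) (DecrA c os is) (HeadBelow c os ⊎ DecrB c os is) b (rowL xs (suc m)) (rowL xs (suc (suc m)))
rimKind {i = i} last zero b 1≤b b≤x _ refl with ℕₚ.m≤n⇒m<n∨m≡n b≤x
... | inj₁ b<x  = A (last (content-monoˡ-< i b<x)) b<x 1≤b
... | inj₂ refl = O (here refl) ℕₚ.≤-refl 1≤b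
rimKind last (suc m) b 1≤b b≤0 _ _ = contradiction (ℕₚ.≤-trans 1≤b b≤0) λ ()
rimKind {i = i} (drop y<x c) zero b 1≤b b≤x y≤b refl with ℕₚ.m≤n⇒m<n∨m≡n b≤x
... | inj₂ refl = O (here refl) ℕₚ.≤-refl y<x
... | inj₁ b<x with ℕₚ.m≤n⇒m<n∨m≡n y≤b
...   | inj₂ refl = I (here refl) b<x ℕₚ.≤-refl
...   | inj₁ y<b  = A (here (content-monoˡ-< i y<b) (content-monoˡ-< i b<x)) b<x y<b
-- Two equal rows force `b` to be their common length, and every outer corner further down has
-- smaller content: the unbounded interval of 𝓑.
rimKind (keep c) zero b 1≤b b≤x x≤b refl with ℕₚ.≤-antisym b≤x x≤b | corners-head c
... | refl | o , os′ , refl , o≤ =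
  B (inj₁ (headBelow (ℤₚ.≤-<-trans o≤ (content-mono-< (ℕₚ.≤-refl {b}) (ℕₚ.n<1+n _))))) x≤b b≤x
rimKind (keep {x = x} c) (suc m) b 1≤b b≤ ≤b eq =
  rimKind c m b 1≤b b≤ ≤b (trans eq (cong (λ n → (+ b) ℤ.- (+ n)) (sym (ℕₚ.+-suc m _))))
rimKind {i = i} (drop {y = y} y<x c) (suc m) b 1≤b b≤ ≤b eq
  with rimKind c m b 1≤b b≤ ≤b (trans eq (cong (λ n → (+ b) ℤ.- (+ n)) (sym (ℕₚ.+-suc m _))))
... | O p e s = O (there p) e s
... | I p e s = I (there p) e s
... | A p e s = A (there p) e s
-- The longer row above contributes an inner corner of content y - i, which exceeds c, so the
-- unbounded interval becomes bounded.
... | B (inj₁ (headBelow o<c)) e s =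
  B (inj₂ (here o<c (subst (ℤ._< (+ y) ℤ.- (+ i)) (sym eq)
    (content-mono-< (ℕₚ.≤-trans b≤ (corners-row≤head c m)) (s≤s (ℕₚ.m≤n+m i m)))))) e s
... | B (inj₂ q) e s = B (inj₂ (there q)) e s

-- Row lengths, column lengths and conjugation.

rowL-step : ∀ {xs} → Linked ℕ._≥_ xs → ∀ i → rowL xs (suc (suc i)) ℕ.≤ rowL xs (suc i)
rowL-step []        i       = z≤n
rowL-step [-]       zero    = z≤n
rowL-step [-]       (suc i) = z≤n
rowL-step (y≤x ∷ l) zero    = y≤x
rowL-step (_ ∷ l)   (suc i) = rowL-step l i

rowL-antitone : ∀ {xs} → Linked ℕ._≥_ xs → ∀ {i k} → 1 ℕ.≤ i → i ℕ.≤ k → rowL xs k ℕ.≤ rowL xs i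
rowL-antitone {xs} l {suc i} {k} _ i≤k = go (ℕₚ.≤⇒≤′ i≤k)
  where
  go : ∀ {k} → suc i ℕ.≤′ k → rowL xs k ℕ.≤ rowL xs (suc i)
  go ℕ.≤′-refl                 = ℕₚ.≤-refl
  go {suc (suc k)} (ℕ.≤′-step i≤k) = ℕₚ.≤-trans (rowL-step l k) (go i≤k)
  go {suc zero} (ℕ.≤′-step (ℕ.≤′-reflexive ()))

count : ℕ → List ℕ → ℕ
count j xs = length (filter (j ℕ.≤?_) xs)

-- Half of the equivalence of i ≤ λ'_j and j ≤ λ_i: the parts decrease weakly, so those that are at
-- least `j` form an initial segment, of length `count j xs`.
≤rowL⇒≤count : ∀ {xs} → Linked ℕ._≥_ xs → ∀ {i j} → 1 ℕ.≤ j → j ℕ.≤ rowL xs i → i ℕ.≤ count j xs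
≤rowL⇒≤count _ {zero} _ _ = z≤n
≤rowL⇒≤count {[]} _ {suc i} 1≤j j≤0 = contradiction (ℕₚ.≤-trans 1≤j j≤0) λ ()
≤rowL⇒≤count {x ∷ xs} l {suc i} {j} 1≤j j≤
  rewrite filter-accept (j ℕ.≤?_) {x} {xs} (ℕₚ.≤-trans j≤ (rowL-antitone l {1} {suc i} (s≤s z≤n) (s≤s z≤n))) = s≤s (go l i j≤)
  where
  go : ∀ {xs} → Linked ℕ._≥_ (x ∷ xs) → ∀ i → j ℕ.≤ rowL (x ∷ xs) (suc i) → i ℕ.≤ count j xs
  go _       zero    _  = z≤n
  go [-]     (suc i) j≤ = ≤rowL⇒≤count [] {suc i} 1≤j j≤
  go (_ ∷ l) (suc i) j≤ = ≤rowL⇒≤count l {suc i} 1≤j j≤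

≤count⇒≤rowL : ∀ {xs} → Linked ℕ._≥_ xs → ∀ {i j} → 1 ℕ.≤ i → i ℕ.≤ count j xs → j ℕ.≤ rowL xs i
≤count⇒≤rowL {[]} _ {suc i} _ ()
≤count⇒≤rowL {x ∷ xs} l {suc i} {j} _ i≤ with j ℕ.≤? x
... | yes j≤x rewrite filter-accept (j ℕ.≤?_) {x} {xs} j≤x = go l i (s≤s⁻¹ i≤)
  where
  go : ∀ {xs} → Linked ℕ._≥_ (x ∷ xs) → ∀ i → i ℕ.≤ count j xs → j ℕ.≤ rowL (x ∷ xs) (suc i)
  go _       zero    _  = j≤x
  go (_ ∷ l) (suc i) i≤ = ≤count⇒≤rowL l {suc i} (s≤s z≤n) i≤
... | no j≰x rewrite filter-reject (j ℕ.≤?_) {x} {xs} j≰x = contradiction (go l i≤) j≰x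
  where
  go : ∀ {xs} → Linked ℕ._≥_ (x ∷ xs) → suc i ℕ.≤ count j xs → j ℕ.≤ x
  go (y≤x ∷ l) i≤ =
    ℕₚ.≤-trans (≤count⇒≤rowL l {suc i} (s≤s z≤n) i≤)
      (ℕₚ.≤-trans (rowL-antitone l {1} {suc i} (s≤s z≤n) (s≤s z≤n)) y≤x)

corners-of-parts : ∀ {xs} → Linked ℕ._≥_ xs → ∀ i → 1 ℕ.≤ rowL xs i →
                   Corners 1 xs (outerContentsFrom 1 xs) (innerContentsFrom 1 xs)
corners-of-parts {[]}     _ zero    ()
corners-of-parts {[]}     _ (suc i) ()
corners-of-parts {x ∷ xs} l _       _ = corners 1 x xs l

-- Contents of neighbouring cells.

content-s : ∀ u → content (sC u) ≡ ℤ.pred (content u)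
content-s (i , j) = ℤₚ.minus-suc (+ j) i

content-e : ∀ u → content (eC u) ≡ ℤ.suc (content u)
content-e (i , j) = ℤₚ.suc-+ j (ℤ.- (+ i))

content-w : ∀ u → 1 ℕ.≤ proj₂ u → content (wC u) ≡ ℤ.pred (content u)
content-w (i , suc j) _ = sym (trans (cong ℤ.pred (content-e (i , j))) (ℤₚ.pred-suc _))

content-diagonal : ∀ k i j → content (k ℕ.+ i , k ℕ.+ j) ≡ content (i , j)
content-diagonal k i j = trans (ℤₚ.m-n≡m⊖n (k ℕ.+ j) (k ℕ.+ i))
  (trans (ℤₚ.+-cancelˡ-⊖ k j i) (sym (ℤₚ.m-n≡m⊖n j i)))

content-row-injective : ∀ i {j l} → content (i , j) ≡ content (i , l) → j ≡ l
content-row-injective i eq = ℤₚ.+-injective (∙-cancelʳ ℤₚ.+-0-abelianGroup (ℤ.- (+ i)) _ _ eq)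

-- Classes of cells along the diagonals of a diagram.

module _ (λp : Partition) where

  ∈λ-row : ∀ i {j} → (i , j) ∈λ λp → 1 ℕ.≤ i
  ∈λ-row zero    (1≤j , j≤0) = contradiction (ℕₚ.≤-trans 1≤j j≤0) λ ()
  ∈λ-row (suc i) _           = s≤s z≤n

  row-antitone : ∀ {i k} → 1 ℕ.≤ i → i ℕ.≤ k → row λp k ℕ.≤ row λp i
  row-antitone = rowL-antitone (decr λp)

  ∈λ⇒corners : ∀ u → u ∈λ λp →
    Corners 1 (parts λp) (outerContentsFrom 1 (parts λp)) (innerContentsFrom 1 (parts λp))
  ∈λ⇒corners (i , j) (1≤j , j≤) = corners-of-parts (decr λp) i (ℕₚ.≤-trans 1≤j j≤)

  ∈λ⇒interlaced : ∀ u → u ∈λ λp →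
    Interlaced (outerContentsFrom 1 (parts λp)) (innerContentsFrom 1 (parts λp))
  ∈λ⇒interlaced u u∈ = corners⇒interlaced (∈λ⇒corners u u∈)

  -- A rim cell is recognised by row λp (suc a) ≤ b, that is, e (s (a , b)) ∉ λ.
  rimCell-kind : ∀ a b u → (a , b) ∈λ λp → row λp (suc a) ℕ.≤ b → u ∈λ λp → content u ≡ content (a , b) →
                 RimKind (inO λp u) (inI λp u) (inA λp u) (inB λp u) b (row λp a) (row λp (suc a))
  rimCell-kind zero    b u r∈ _ _ _ = contradiction (∈λ-row 0 r∈) λ ()
  rimCell-kind (suc m) b u r∈@(1≤b , b≤) ≤b u∈ eq
    with rimKind (∈λ⇒corners (suc m , b) r∈) m b 1≤b b≤ ≤b (trans eq (cong (λ n → (+ b) ℤ.- (+ n)) (ℕₚ.+-comm 1 m)))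
  ... | O p e s        = O (u∈ , Any.reverse⁺ p) e s
  ... | I p e s        = I (u∈ , Any.reverse⁺ p) e s
  ... | A p e s        = A (u∈ , decrA⇒InA (∈λ⇒interlaced u u∈) p) e s
  ... | B (inj₁ p) e s = B (u∈ , headBelow⇒InB (∈λ⇒interlaced u u∈) p) e s
  ... | B (inj₂ p) e s = B (u∈ , inj₁ (decrB⇒InB (∈λ⇒interlaced u u∈) p)) e s

  inBI inOA inIA inOB : Cell → Set
  inBI u = inB λp u ⊎ inI λp u
  inOA u = inO λp u ⊎ inA λp u
  inIA u = inI λp u ⊎ inA λp u
  inOB u = inO λp u ⊎ inB λp u

  inOA⇒DecrOA : ∀ u → inOA u → Interlaced (outerContentsFrom 1 (parts λp)) (innerContentsFrom 1 (parts λp)) ×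
                DecrOA (content u) (outerContentsFrom 1 (parts λp)) (innerContentsFrom 1 (parts λp))
  inOA⇒DecrOA u (inj₁ (u∈ , p)) = let il = ∈λ⇒interlaced u u∈ in il , O⇒DecrOA il (Any.reverse⁻ p)
  inOA⇒DecrOA u (inj₂ (u∈ , p)) = let il = ∈λ⇒interlaced u u∈ in il , InA⇒DecrOA il p

  inOA⇒¬inBI : ∀ u → inOA u → ¬ inBI u
  inOA⇒¬inBI u oa bi with inOA⇒DecrOA u oa | bi
  ... | il , oa′ | inj₁ (_ , inj₁ (_ , _ , _ , eqo , eqi , a<c , c<b)) = OA∩BI il oa′ (InB⇒DecrBI il eqo eqi a<c c<b)
  ... | il , oa′ | inj₁ (_ , inj₂ (_ , eq , o<c))                      = OA∩HeadBelow il oa′ (InB⇒HeadBelow il eq o<c)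
  ... | il , oa′ | inj₂ (_ , p)                                        = OA∩BI il oa′ (I⇒DecrBI il (Any.reverse⁻ p))

  -- Walking south-east along the diagonal until the next cell leaves λ ends on the rim. Classes
  -- depend on the content alone, so the class of a cell can be read off there.
  rimCell : ∀ i j → (i , j) ∈λ λp →
            Σ ℕ λ k → ((k ℕ.+ i , k ℕ.+ j) ∈λ λp) × (row λp (suc (k ℕ.+ i)) ℕ.≤ k ℕ.+ j)
  rimCell i j u∈ = go (row λp i) i j u∈ (ℕₚ.m≤m+n (row λp i) j)
    where
    -- `n` bounds the diagonal steps still possible: each raises the column by one while the row
    -- length does not grow.
    go : ∀ n i j → (i , j) ∈λ λp → row λp i ℕ.≤ n ℕ.+ j →
         Σ ℕ λ k → ((k ℕ.+ i , k ℕ.+ j) ∈λ λp) × (row λp (suc (k ℕ.+ i)) ℕ.≤ k ℕ.+ j)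
    go n i j u∈ bound with suc j ℕ.≤? row λp (suc i)
    ... | no  j≮ = 0 , u∈ , ℕₚ.≮⇒≥ j≮
    go zero    i j u∈ bound | yes j< =
      contradiction (ℕₚ.≤-trans j< (ℕₚ.≤-trans (row-antitone (∈λ-row i u∈) (ℕₚ.n≤1+n i)) bound)) (ℕₚ.<-irrefl refl)
    go (suc n) i j u∈ bound | yes j<
      with go n (suc i) (suc j) (s≤s z≤n , j<)
             (ℕₚ.≤-trans (row-antitone (∈λ-row i u∈) (ℕₚ.n≤1+n i)) (subst (row λp i ℕ.≤_) (sym (ℕₚ.+-suc n j)) bound))
    ... | k , r∈ , r-rim rewrite ℕₚ.+-suc k i | ℕₚ.+-suc k j = suc k , r∈ , r-rim

  IA∪OB : ∀ u → u ∈λ λp → inIA u ⊎ inOB u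
  IA∪OB (i , j) u∈ with rimCell i j u∈
  ... | k , r∈ , r-rim with rimCell-kind (k ℕ.+ i) (k ℕ.+ j) (i , j) r∈ r-rim u∈ (sym (content-diagonal k i j))
  ...   | O p _ _ = inj₂ (inj₁ p)
  ...   | I p _ _ = inj₁ (inj₁ p)
  ...   | A p _ _ = inj₁ (inj₂ p)
  ...   | B p _ _ = inj₂ (inj₂ p)

  rim-east⇒inIA : ∀ a b u → (a , b) ∈λ λp → row λp (suc a) ℕ.≤ b → b ℕ.< row λp a →
                  u ∈λ λp → content u ≡ content (a , b) → inIA u
  rim-east⇒inIA a b u r∈ r-rim b< u∈ eq with rimCell-kind a b u r∈ r-rim u∈ eq
  ... | I p _ _  = inj₁ p
  ... | A p _ _  = inj₂ p
  ... | O _ ≤b _ = contradiction b< (ℕₚ.≤⇒≯ ≤b)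
  ... | B _ ≤b _ = contradiction b< (ℕₚ.≤⇒≯ ≤b)

  bottom⇒inOA : ∀ a b u → (a , b) ∈λ λp → row λp (suc a) ℕ.< b →
                u ∈λ λp → content u ≡ content (a , b) → inOA u
  bottom⇒inOA a b u r∈ <b u∈ eq with rimCell-kind a b u r∈ (ℕₚ.<⇒≤ <b) u∈ eq
  ... | O p _ _  = inj₁ p
  ... | A p _ _  = inj₂ p
  ... | I _ _ b≤ = contradiction <b (ℕₚ.≤⇒≯ b≤)
  ... | B _ _ b≤ = contradiction <b (ℕₚ.≤⇒≯ b≤)

  ¬inBI⇒rim-bottom : ∀ i j → (i , j) ∈λ λp → ¬ inBI (i , j) →
                     Σ ℕ λ k → ((k ℕ.+ i , k ℕ.+ j) ∈λ λp) × (row λp (suc (k ℕ.+ i)) ℕ.< k ℕ.+ j)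
  ¬inBI⇒rim-bottom i j u∈ ¬bi with rimCell i j u∈
  ... | k , r∈ , r-rim with rimCell-kind (k ℕ.+ i) (k ℕ.+ j) (i , j) r∈ r-rim u∈ (sym (content-diagonal k i j))
  ...   | O _ _ <b = k , r∈ , <b
  ...   | A _ _ <b = k , r∈ , <b
  ...   | I p _ _  = contradiction (inj₂ p) ¬bi
  ...   | B p _ _  = contradiction (inj₁ p) ¬bi

  -- The rim enters a diagonal outside 𝓑 ∪ 𝓘 by an eastward step, so it leaves
  -- the preceding diagonal by an eastward step.
  next-of-¬inBI : ∀ u {v} → u ∈λ λp → ¬ inBI u → v ∈λ λp → v ≡ sC u ⊎ v ≡ wC u → inIA v
  next-of-¬inBI (i , j) u∈ ¬bi v∈@(1≤j , j≤) (inj₁ refl) with ¬inBI⇒rim-bottom i j u∈ ¬bi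
  -- If `u` is itself the rim cell, it has no southern neighbour. Otherwise the cell west of the rim
  -- cell lies on the diagonal of `v` and has an east neighbour in λ.
  ... | zero  , r∈ , <b = contradiction <b (ℕₚ.≤⇒≯ j≤)
  ... | suc k , (_ , ≤row) , <b =
    rim-east⇒inIA (suc (k ℕ.+ i)) (k ℕ.+ j) (suc i , j)
      (ℕₚ.≤-trans 1≤j (ℕₚ.m≤n+m j k) , ℕₚ.<⇒≤ ≤row) (s≤s⁻¹ <b) ≤row v∈
      (trans (sym (content-diagonal k (suc i) j)) (cong (λ a → content (a , k ℕ.+ j)) (ℕₚ.+-suc k i)))
  next-of-¬inBI (i , suc j) u∈ ¬bi v∈@(1≤j , _) (inj₂ refl) with ¬inBI⇒rim-bottom i (suc j) u∈ ¬bi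
  ... | k , (_ , ≤row) , <b rewrite ℕₚ.+-suc k j =
    rim-east⇒inIA (k ℕ.+ i) (k ℕ.+ j) (i , j)
      (ℕₚ.≤-trans 1≤j (ℕₚ.m≤n+m j k) , ℕₚ.<⇒≤ ≤row) (s≤s⁻¹ <b) ≤row v∈ (sym (content-diagonal k i j))

  ∈λ⇒≤col : ∀ i j → (i , j) ∈λ λp → i ℕ.≤ col λp j
  ∈λ⇒≤col i j (1≤j , j≤) = ≤rowL⇒≤count (decr λp) 1≤j j≤

  column-bottom : ∀ i j → (i , j) ∈λ λp → (col λp j , j) ∈λ λp
  column-bottom i j u∈ =
    proj₁ u∈ , ≤count⇒≤rowL (decr λp) (ℕₚ.≤-trans (∈λ-row i u∈) (∈λ⇒≤col i j u∈)) ℕₚ.≤-refl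

  below-column : ∀ i j → (i , j) ∈λ λp → row λp (suc (col λp j)) ℕ.< j
  below-column i j (1≤j , _) = ℕₚ.≰⇒> λ j≤ → ℕₚ.<-irrefl refl (∈λ⇒≤col (suc (col λp j)) j (1≤j , j≤))

  col-antitone : ∀ i j l → (i , j) ∈λ λp → 1 ℕ.≤ l → l ℕ.≤ j → col λp j ℕ.≤ col λp l
  col-antitone i j l u∈ 1≤l l≤j =
    ∈λ⇒≤col (col λp j) l (1≤l , ℕₚ.≤-trans l≤j (proj₂ (column-bottom i j u∈)))

content-pred-< : ∀ {u v} → content v ≡ ℤ.pred (content u) → content v ℤ.< content u
content-pred-< eq = ℤₚ.i≤pred[j]⇒i<j (ℤₚ.≤-reflexive eq)

-- Adding and removing a path.

memC-∈ : ∀ {u P} → u ∈ P → memC u P ≡ true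
memC-∈ {u} {v ∷ P} m with u ≟C v
memC-∈ m           | yes _  = refl
memC-∈ (here refl) | no u≢v = contradiction refl u≢v
memC-∈ (there m)   | no _   = memC-∈ m

memC-∉ : ∀ {u P} → u ∉ P → memC u P ≡ false
memC-∉ {u} {[]}    _ = refl
memC-∉ {u} {v ∷ P} ∉ with u ≟C v
... | yes u≡v = contradiction (here u≡v) ∉
... | no _    = memC-∉ (∉ ∘ there)

+P-∈ : ∀ σ {u P} → u ∈ P → (σ +P P) u ≡ suc (σ u)
+P-∈ σ u∈P rewrite memC-∈ u∈P = refl

+P-∉ : ∀ σ {u P} → u ∉ P → (σ +P P) u ≡ σ u
+P-∉ σ u∉P rewrite memC-∉ u∉P = refl

≤+P : ∀ σ P u → σ u ℕ.≤ (σ +P P) u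
≤+P σ P u with memC u P
... | true  = ℕₚ.n≤1+n (σ u)
... | false = ℕₚ.≤-refl

-P-∈ : ∀ σ {u P} → u ∈ P → (σ -P P) u ≡ σ u ∸ 1
-P-∈ σ u∈P rewrite memC-∈ u∈P = refl

-P-∉ : ∀ σ {u P} → u ∉ P → (σ -P P) u ≡ σ u
-P-∉ σ u∉P rewrite memC-∉ u∉P = refl

fin-injective : ∀ {m n} → fin m ≡ fin n → m ≡ n
fin-injective refl = refl

fin<fin⁻¹ : ∀ {m n} → fin m <∞ fin n → m ℕ.< n
fin<fin⁻¹ (fin<fin m<n) = m<n

fin≤fin⁻¹ : ∀ {m n} → fin m ≤∞ fin n → m ℕ.≤ n
fin≤fin⁻¹ (fin≤fin m≤n) = m≤n

-- Fillings and paths in a fixed diagram.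

module _ (λp : Partition) where

  at-∈λ : ∀ π u → u ∈λ λp → at λp π u ≡ fin (π u)
  at-∈λ π (zero  , j)     (1≤j , j≤0) = contradiction (ℕₚ.≤-trans 1≤j j≤0) λ ()
  at-∈λ π (suc i , suc j) (_ , j≤) with suc j ℕ.≤? row λp (suc i)
  ... | yes _ = refl
  ... | no j≰ = contradiction j≤ j≰

  at-cong : ∀ {π σ} → π ≈[ λp ] σ → ∀ u → at λp π u ≡ at λp σ u
  at-cong π≈σ (zero  , j)     = refl
  at-cong π≈σ (suc i , zero)  = refl
  at-cong π≈σ (suc i , suc j) with suc j ℕ.≤? row λp (suc i)
  ... | yes j≤ = cong fin (π≈σ (suc i , suc j) (s≤s z≤n , j≤))
  ... | no  _  = refl

  IsRPP-cong : ∀ {π σ} → π ≈[ λp ] σ → IsRPP λp σ → IsRPP λp π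
  IsRPP-cong π≈σ rpp u u∈ rewrite at-cong π≈σ u | at-cong π≈σ (eC u) | at-cong π≈σ (sC u) = rpp u u∈

  rpp-s : ∀ {π} → IsRPP λp π → ∀ u → u ∈λ λp → sC u ∈λ λp → π u ℕ.≤ π (sC u)
  rpp-s {π} rpp u u∈ su∈ = fin≤fin⁻¹ (subst₂ _≤∞_ (at-∈λ π u u∈) (at-∈λ π (sC u) su∈) (proj₂ (rpp u u∈)))

  rpp-e : ∀ {π} → IsRPP λp π → ∀ u → u ∈λ λp → eC u ∈λ λp → π u ℕ.≤ π (eC u)
  rpp-e {π} rpp u u∈ eu∈ = fin≤fin⁻¹ (subst₂ _≤∞_ (at-∈λ π u u∈) (at-∈λ π (eC u) eu∈) (proj₁ (rpp u u∈)))

  -- A north or west neighbour of a cell of λ is again in λ or falls into row 0 or column 0, where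
  -- the convention fixes the value 0 for every filling.
  data BoundaryOrCell (y : Cell) : Set where
    boundary : (∀ π → at λp π y ≡ fin 0) → BoundaryOrCell y
    cell     : y ∈λ λp → BoundaryOrCell y

  north-cell : ∀ u → u ∈λ λp → BoundaryOrCell (nC u)
  north-cell (zero , j)        u∈         = boundary λ _ → refl
  north-cell (suc zero , j)    u∈         = boundary λ _ → refl
  north-cell (suc (suc i) , j) (1≤j , j≤) = cell (1≤j , ℕₚ.≤-trans j≤ (row-antitone λp (s≤s z≤n) (ℕₚ.n≤1+n _)))

  west-cell : ∀ u → u ∈λ λp → BoundaryOrCell (wC u)
  west-cell (zero  , j)           u∈       = boundary λ _ → refl
  west-cell (suc i , suc zero)    u∈       = boundary λ _ → refl
  west-cell (suc i , suc (suc j)) (_ , j≤) = cell (s≤s z≤n , ℕₚ.<⇒≤ j≤)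

  rpp-n : ∀ {π} → IsRPP λp π → ∀ u → u ∈λ λp → nC u ∈λ λp → π (nC u) ℕ.≤ π u
  rpp-n rpp (zero  , j) u∈ _   = contradiction (∈λ-row λp 0 u∈) λ ()
  rpp-n rpp (suc i , j) u∈ nu∈ = rpp-s rpp (i , j) nu∈ u∈

  rpp-w : ∀ {π} → IsRPP λp π → ∀ u → u ∈λ λp → wC u ∈λ λp → π (wC u) ℕ.≤ π u
  rpp-w rpp (i , suc j) u∈ wu∈ = rpp-e rpp (i , j) wu∈ u∈

  -- Contents along south-west paths.

  step-content : ∀ u {v} → u ∈λ λp → v ≡ sC u ⊎ v ≡ wC u → content v ≡ ℤ.pred (content u)
  step-content u u∈ (inj₁ refl) = content-s u
  step-content u u∈ (inj₂ refl) = content-w u (proj₁ u∈)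

  content-n : ∀ u → u ∈λ λp → content (nC u) ≡ ℤ.suc (content u)
  content-n (zero  , j) u∈ = contradiction (∈λ-row λp 0 u∈) λ ()
  content-n (suc i , j) u∈ = sym (trans (cong ℤ.suc (content-s (i , j))) (ℤₚ.suc-pred _))

  SWPath-≤ : ∀ {u P x} → SWPath λp (u ∷ P) → x ∈ u ∷ P → content x ℤ.≤ content u
  SWPath-< : ∀ {u v P x} → SWPath λp (u ∷ v ∷ P) → x ∈ v ∷ P → content x ℤ.< content u

  SWPath-≤ _                 (here refl) = ℤₚ.≤-refl
  SWPath-≤ p@(step _ _ _)    (there m)   = ℤₚ.<⇒≤ (SWPath-< p m)
  SWPath-< {u} {v} (step u∈ dir p) m = ℤₚ.≤-<-trans (SWPath-≤ p m) (content-pred-< {u} {v} (step-content u u∈ dir))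

  SWPath-content-injective : ∀ {P x y} → SWPath λp P → x ∈ P → y ∈ P → content x ≡ content y → x ≡ y
  SWPath-content-injective p              (here refl) (here refl) _  = refl
  SWPath-content-injective p@(step _ _ _) (here refl) (there m)   eq = contradiction (SWPath-< p m) (ℤₚ.<-irrefl (sym eq))
  SWPath-content-injective p@(step _ _ _) (there m)   (here refl) eq = contradiction (SWPath-< p m) (ℤₚ.<-irrefl eq)
  SWPath-content-injective (step _ _ p)   (there m)   (there m′)  eq = SWPath-content-injective p m m′ eq

  SWPath-∈λ : ∀ {P x} → SWPath λp P → x ∈ P → x ∈λ λp
  SWPath-∈λ (one u∈)      (here refl) = u∈
  SWPath-∈λ (step u∈ _ _) (here refl) = u∈
  SWPath-∈λ (step _ _ p)  (there m)   = SWPath-∈λ p m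

  InsPath-head∈ : ∀ {σ k u P} → InsPath λp σ k u P → u ∈ P
  InsPath-head∈ (done _)        = here refl
  InsPath-head∈ (south _ _ _ _) = here refl
  InsPath-head∈ (west _ _ _)    = here refl

  InsPath-head∈λ : ∀ {σ k u P} → InsPath λp σ k u P → u ∈λ λp
  InsPath-head∈λ (done u∈)        = u∈
  InsPath-head∈λ (south u∈ _ _ _) = u∈
  InsPath-head∈λ (west u∈ _ _)    = u∈

  prepend : ∀ {σ k u v P} → u ∈λ λp → v ≡ sC u ⊎ v ≡ wC u → InsPath λp σ k v P → SWPath λp P → SWPath λp (u ∷ P)
  prepend u∈ dir (done _)        p = step u∈ dir p
  prepend u∈ dir (south _ _ _ _) p = step u∈ dir p
  prepend u∈ dir (west _ _ _)    p = step u∈ dir p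

  InsPath⇒SWPath : ∀ {σ k u P} → InsPath λp σ k u P → SWPath λp P
  InsPath⇒SWPath (done u∈)        = one u∈
  InsPath⇒SWPath (south u∈ _ _ p) = prepend u∈ (inj₁ refl) p (InsPath⇒SWPath p)
  InsPath⇒SWPath (west u∈ _ p)    = prepend u∈ (inj₂ refl) p (InsPath⇒SWPath p)

  sC≢wC : ∀ u → sC u ≢ wC u
  sC≢wC (i , j) eq = ℕₚ.1+n≢n (cong proj₁ eq)

  -- The south and west neighbours of a cell share a diagonal, which a path meets at most once. The
  -- next lemma uses the same argument for north and east.
  s-w-exclusive : ∀ {W} u → SWPath λp W → u ∈λ λp → wC u ∈ W → sC u ∉ W
  s-w-exclusive u sw u∈ wu∈ su∈ =
    sC≢wC u (SWPath-content-injective sw su∈ wu∈ (trans (content-s u) (sym (content-w u (proj₁ u∈)))))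

  n-e-exclusive : ∀ {W} u → SWPath λp W → u ∈λ λp → eC u ∈ W → nC u ∉ W
  n-e-exclusive (zero  , j) sw u∈ _   _   = contradiction (∈λ-row λp 0 u∈) λ ()
  n-e-exclusive (suc i , j) sw u∈ eu∈ nu∈ =
    ℕₚ.1+n≢n (cong proj₁ (SWPath-content-injective sw eu∈ nu∈
      (trans (content-e (suc i , j)) (sym (content-n (suc i , j) u∈)))))

  eC-wC : ∀ u → u ∈λ λp → eC (wC u) ≡ u
  eC-wC (i , suc j) _ = refl

  -- The induction runs along the tail `u ∷ R` while the whole path `W` stays fixed, since
  -- compatibility speaks of membership in `W`. Only the two diverging steps need an argument.
  compatible-path-unique :
    ∀ {σ W} → SWPath λp W → Compatible λp W σ → IsRPP λp (σ +P W) →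
    ∀ {k u P R} → InsPath λp σ k u P → SWPath λp (u ∷ R) → (∀ {x} → x ∈ u ∷ R → x ∈ W) → length R ≡ k → P ≡ u ∷ R
  compatible-path-unique swW comp rpp (done _) (one _) _ _ = refl
  compatible-path-unique swW comp rpp (south _ _ _ p) (step _ (inj₁ refl) sw) ⊆W len =
    cong (_ ∷_) (compatible-path-unique swW comp rpp p sw (⊆W ∘ there) (ℕₚ.suc-injective len))
  compatible-path-unique swW comp rpp (west _ _ p) (step _ (inj₂ refl) sw) ⊆W len =
    cong (_ ∷_) (compatible-path-unique swW comp rpp p sw (⊆W ∘ there) (ℕₚ.suc-injective len))
  -- The rule goes south but `W` goes west: then `s u` is not raised, and the equality of the
  -- entries at `u` and `s u` turns into a descent down the column.
  compatible-path-unique {σ} {W} swW comp rpp {u = u} (south u∈ _ eq p) (step _ (inj₂ refl) sw) ⊆W _ =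
    contradiction (rpp-s rpp u u∈ su∈) (ℕₚ.<⇒≱ (begin-strict
      (σ +P W) (sC u) ≡⟨ +P-∉ σ (s-w-exclusive u swW u∈ (⊆W (there (here refl)))) ⟩
      σ (sC u)        ≡⟨ fin-injective (trans (sym (at-∈λ σ (sC u) su∈)) (trans (sym eq) (at-∈λ σ u u∈))) ⟩
      σ u             <⟨ ℕₚ.n<1+n (σ u) ⟩
      suc (σ u)       ≡⟨ +P-∈ σ (⊆W (here refl)) ⟨
      (σ +P W) u      ∎))
    where
    open ℕₚ.≤-Reasoning
    su∈ = InsPath-head∈λ p
  -- The rule goes west but `W` goes south: compatibility makes the entries equal, so `u` is outside
  -- 𝓑 ∪ 𝓘 and `s u` is in 𝓘 ∪ 𝓐. Then `W` must contain `e (s u)`, on the diagonal of `u`.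
  compatible-path-unique {σ} {W} swW comp rpp {u = u} (west u∈ ¬south p) (step _ (inj₁ refl) sw) ⊆W _ =
    contradiction (cong proj₁ (SWPath-content-injective swW esu∈W u∈W
      (trans (content-e (sC u)) (trans (cong ℤ.suc (content-s u)) (ℤₚ.suc-pred _))))) ℕₚ.1+n≢n
    where
    u∈W  = ⊆W (here refl)
    su∈W = ⊆W (there (here refl))
    su∈  = SWPath-∈λ sw (here refl)
    at≡ : at λp σ u ≡ at λp σ (sC u)
    at≡ = trans (at-∈λ σ u u∈) (trans (cong fin (proj₂ comp u u∈W su∈W)) (sym (at-∈λ σ (sC u) su∈)))
    esu∈W : eC (sC u) ∈ W
    esu∈W = proj₁ (proj₁ comp (sC u) su∈W
      (next-of-¬inBI λp u u∈ (λ bi → ¬south (bi , at≡)) su∈ (inj₁ refl)))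

  -- `Inserts` only asserts that some suitable path exists; uniqueness identifies it with P(h , σ).
  inserts⇒compatible : ∀ {σ h P} → Inserts λp h σ → IsInsertionPath λp h σ P →
                       Compatible λp P σ × IsRPP λp (σ +P P)
  inserts⇒compatible (u ∷ R , sw , refl , len , comp , rpp) ip
    with compatible-path-unique sw comp rpp ip sw (λ m → m) len
  ... | refl = comp , rpp

  InsPath-functional : ∀ {σ τ} → σ ≈[ λp ] τ → ∀ {k u P R} → InsPath λp σ k u P → InsPath λp τ k u R → P ≡ R
  InsPath-functional σ≈τ (done _) (done _) = refl
  InsPath-functional σ≈τ (south _ _ _ p) (south _ _ _ q) = cong (_ ∷_) (InsPath-functional σ≈τ p q)
  InsPath-functional σ≈τ (west _ _ p)    (west _ _ q)    = cong (_ ∷_) (InsPath-functional σ≈τ p q)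
  InsPath-functional σ≈τ {u = u} (south _ bi eq _) (west _ ¬south _) =
    contradiction (bi , trans (sym (at-cong σ≈τ u)) (trans eq (at-cong σ≈τ (sC u)))) ¬south
  InsPath-functional σ≈τ {u = u} (west _ ¬south _) (south _ bi eq _) =
    contradiction (bi , trans (at-cong σ≈τ u) (trans eq (sym (at-cong σ≈τ (sC u))))) ¬south

  +P-cong : ∀ {σ τ} P → σ ≈[ λp ] τ → (σ +P P) ≈[ λp ] (τ +P P)
  +P-cong P σ≈τ u u∈ with memC u P
  ... | true  = cong suc (σ≈τ u u∈)
  ... | false = σ≈τ u u∈

  -- Lets the filling σ given in the theorem be exchanged for the one inside the factorisation of π;
  -- the two have the same hooks.
  HookFact-functional : ∀ {hs σ τ} → HookFact λp hs σ → HookFact λp hs τ → σ ≈[ λp ] τ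
  HookFact-functional (nil σ≈0) (nil τ≈0) u u∈ = trans (σ≈0 u u∈) (sym (τ≈0 u u∈))
  HookFact-functional (cons {P = P} _ f _ p σ≈) (cons {P = R} _ g _ q τ≈) u u∈
    with HookFact-functional f g
  ... | IH with InsPath-functional IH p q
  ...   | refl = trans (σ≈ u u∈) (trans (+P-cong P IH u u∈) (sym (τ≈ u u∈)))

  -- The head α(P) of an insertion path, which is listed last, and its content.

  endOf : ∀ {σ k u P} → InsPath λp σ k u P → Cell
  endOf (done {u} _)     = u
  endOf (south _ _ _ p)  = endOf p
  endOf (west _ _ p)     = endOf p

  endOf∈ : ∀ {σ k u P} (p : InsPath λp σ k u P) → endOf p ∈ P
  endOf∈ (done _)        = here refl
  endOf∈ (south _ _ _ p) = there (endOf∈ p)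
  endOf∈ (west _ _ p)    = there (endOf∈ p)

  content-prepend : ∀ k u {v} c → u ∈λ λp → v ≡ sC u ⊎ v ≡ wC u → content v ≡ + k ℤ.+ c →
                    content u ≡ + suc k ℤ.+ c
  content-prepend k u c u∈ dir eq = begin
    content u                      ≡⟨ ℤₚ.suc-pred _ ⟨
    ℤ.suc (ℤ.pred (content u))     ≡⟨ cong ℤ.suc (trans (sym (step-content u u∈ dir)) eq) ⟩
    ℤ.suc (+ k ℤ.+ c)              ≡⟨ ℤₚ.suc-+ k c ⟨
    + suc k ℤ.+ c                  ∎
    where open ≡-Reasoning

  content-endOf : ∀ {σ k u P} (p : InsPath λp σ k u P) → content u ≡ + k ℤ.+ content (endOf p)
  content-endOf (done _) = sym (ℤₚ.+-identityˡ _)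
  content-endOf {u = u} (south {k} u∈ _ _ p) = content-prepend k u (content (endOf p)) u∈ (inj₁ refl) (content-endOf p)
  content-endOf {u = u} (west {k} u∈ _ p)    = content-prepend k u (content (endOf p)) u∈ (inj₂ refl) (content-endOf p)

  endOf-≤ : ∀ {σ k u P x} (p : InsPath λp σ k u P) → x ∈ P → content (endOf p) ℤ.≤ content x
  endOf-≤ (done _)          (here refl) = ℤₚ.≤-refl
  endOf-≤ (south _ _ _ p)   (there m)   = endOf-≤ p m
  endOf-≤ (west _ _ p)      (there m)   = endOf-≤ p m
  endOf-≤ {u = u} (south u∈ _ _ p) (here refl) =
    ℤₚ.≤-trans (endOf-≤ p (InsPath-head∈ p)) (ℤₚ.<⇒≤ (content-pred-< {u} {sC u} (content-s u)))
  endOf-≤ {u = u} (west u∈ _ p) (here refl) =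
    ℤₚ.≤-trans (endOf-≤ p (InsPath-head∈ p)) (ℤₚ.<⇒≤ (content-pred-< {u} {wC u} (content-w u (proj₁ u∈))))

  -- A south step requires a cell of 𝓑 ∪ 𝓘, which is disjoint from 𝓞 ∪ 𝓐.
  OA-goes-west : ∀ {σ k u P x} (p : InsPath λp σ k u P) → x ∈ P → inOA λp x → x ≡ endOf p ⊎ wC x ∈ P
  OA-goes-west (done _)         (here refl) _  = inj₁ refl
  OA-goes-west {u = u} (south _ bi _ _) (here refl) oa = contradiction bi (inOA⇒¬inBI λp u oa)
  OA-goes-west (west _ _ p)     (here refl) _  = inj₂ (there (InsPath-head∈ p))
  OA-goes-west (south _ _ _ p)  (there m)   oa = [ inj₁ , inj₂ ∘ there ]′ (OA-goes-west p m oa)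
  OA-goes-west (west _ _ p)     (there m)   oa = [ inj₁ , inj₂ ∘ there ]′ (OA-goes-west p m oa)

  -- A single insertion: entries, candidates and the reversed path.

  module Insertion
    {σ π : Filling} {k ω P} (p : InsPath λp σ k ω P) (comp : Compatible λp P σ) (rpp : IsRPP λp σ)
    (π≈ : π ≈[ λp ] (σ +P P)) where

    swP : SWPath λp P
    swP = InsPath⇒SWPath p

    ∈P⇒∈λ : ∀ {x} → x ∈ P → x ∈λ λp
    ∈P⇒∈λ = SWPath-∈λ swP

    value-∈ : ∀ x → x ∈ P → π x ≡ suc (σ x)
    value-∈ x x∈P = trans (π≈ x (∈P⇒∈λ x∈P)) (+P-∈ σ x∈P)

    value-∉ : ∀ x → x ∈λ λp → x ∉ P → π x ≡ σ x
    value-∉ x x∈ x∉P = trans (π≈ x x∈) (+P-∉ σ x∉P)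

    value-≥ : ∀ x → x ∈λ λp → σ x ℕ.≤ π x
    value-≥ x x∈ = subst (σ x ℕ.≤_) (sym (π≈ x x∈)) (≤+P σ P x)

    -- Raising `x` but not `y` makes a weak inequality strict; on the boundary, 0 lies below every
    -- raised entry.
    below-∈ : ∀ x y → x ∈ P → y ∉ P → BoundaryOrCell y → (y ∈λ λp → σ y ℕ.≤ σ x) → at λp π y <∞ at λp π x
    below-∈ x y x∈P y∉P bc σy≤σx rewrite at-∈λ π x (∈P⇒∈λ x∈P) | value-∈ x x∈P with bc
    ... | boundary at≡0 rewrite at≡0 π                       = fin<fin (s≤s z≤n)
    ... | cell y∈ rewrite at-∈λ π y y∈ | value-∉ y y∈ y∉P = fin<fin (s≤s (σy≤σx y∈))

    north-below : ∀ x → x ∈ P → nC x ∉ P → at λp π (nC x) <∞ at λp π x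
    north-below x x∈P ∉P = below-∈ x (nC x) x∈P ∉P (north-cell x x∈) (rpp-n rpp x x∈)
      where x∈ = ∈P⇒∈λ x∈P

    west-below : ∀ x → x ∈ P → wC x ∉ P → at λp π (wC x) <∞ at λp π x
    west-below x x∈P ∉P = below-∈ x (wC x) x∈P ∉P (west-cell x x∈) (rpp-w rpp x x∈)
      where x∈ = ∈P⇒∈λ x∈P

    -- Returning from π to σ leaves the entry at `x` alone and can only lower the one at `y`.
    below-∉ : ∀ x y → x ∈λ λp → x ∉ P → BoundaryOrCell y → at λp π y <∞ at λp π x → at λp σ y <∞ at λp σ x
    below-∉ x y x∈ x∉P bc lt rewrite at-∈λ π x x∈ | at-∈λ σ x x∈ | value-∉ x x∈ x∉P with bc
    ... | boundary at≡0 rewrite at≡0 π | at≡0 σ = lt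
    ... | cell y∈ rewrite at-∈λ π y y∈ | at-∈λ σ y y∈ = fin<fin (ℕₚ.≤-<-trans (value-≥ y y∈) (fin<fin⁻¹ lt))

    end : Cell
    end = endOf p

    end∈P : end ∈ P
    end∈P = endOf∈ p

    end∈λ : end ∈λ λp
    end∈λ = ∈P⇒∈λ end∈P

    west-of-end∉P : wC end ∉ P
    west-of-end∉P m = ℤₚ.≤⇒≯ (endOf-≤ p m) (content-pred-< {end} {wC end} (content-w end (proj₁ end∈λ)))

    end-cand : inOA λp end → Cand λp π end
    end-cand (inj₁ o) = inj₁ (o , west-below end end∈P west-of-end∉P)
    -- In 𝓐, compatibility puts the east neighbour on the path, which keeps the north neighbour off
    -- it.
    end-cand (inj₂ a) = inj₂ (a , west-below end end∈P west-of-end∉P ,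
      north-below end end∈P (n-e-exclusive end swP end∈λ (proj₁ (proj₁ comp end end∈P (inj₂ a)))))

    OA-∈P⇒end : ∀ x → x ∈ P → inOA λp x → at λp π (wC x) <∞ at λp π x → x ≡ end
    OA-∈P⇒end x x∈P oa lt with OA-goes-west p x∈P oa
    ... | inj₁ x≡end = x≡end
    ... | inj₂ wx∈P  = contradiction (fin<fin⁻¹ (subst₂ _<∞_ (at-∈λ π (wC x) wx∈) (at-∈λ π x x∈) lt)) (ℕₚ.<-irrefl πwx≡πx)
      where
      x∈  = ∈P⇒∈λ x∈P
      wx∈ = ∈P⇒∈λ wx∈P
      σwx≡σx : σ (wC x) ≡ σ x
      σwx≡σx = trans (proj₂ (proj₁ comp (wC x) wx∈P (next-of-¬inBI λp x x∈ (inOA⇒¬inBI λp x oa) wx∈ (inj₂ refl))))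
                     (cong σ (eC-wC x x∈))
      πwx≡πx : π (wC x) ≡ π x
      πwx≡πx = trans (value-∈ (wC x) wx∈P) (trans (cong suc σwx≡σx) (sym (value-∈ x x∈P)))

    cand⇒end-or-cand : ∀ x → Cand λp π x → x ≡ end ⊎ Cand λp σ x
    cand⇒end-or-cand x c with x ∈? P
    cand⇒end-or-cand x (inj₁ (o , w<))      | yes x∈P = inj₁ (OA-∈P⇒end x x∈P (inj₁ o) w<)
    cand⇒end-or-cand x (inj₂ (a , w< , _))  | yes x∈P = inj₁ (OA-∈P⇒end x x∈P (inj₂ a) w<)
    cand⇒end-or-cand x (inj₁ (o@(x∈ , _) , w<)) | no x∉P =
      inj₂ (inj₁ (o , below-∉ x (wC x) x∈ x∉P (west-cell x x∈) w<))
    cand⇒end-or-cand x (inj₂ (a@(x∈ , _) , w< , n<)) | no x∉P =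
      inj₂ (inj₂ (a , below-∉ x (wC x) x∈ x∉P (west-cell x x∈) w< , below-∉ x (nC x) x∈ x∉P (north-cell x x∈) n<))

    -- Q is built backwards, from ω to α. The argument `Q` accumulates the portion already traced,
    -- in north-east order; this is why the result is a `reverseAcc`.
    retrace : ∀ {k u S Q} (q : InsPath λp σ k u S) → (∀ {x} → x ∈ S → x ∈ P) → IsQ λp π u Q →
              Σ (List Cell) λ R → S ≡ u ∷ R × IsQ λp π (endOf q) (reverseAcc Q R)
    retrace (done _) _ isQ = [] , refl , isQ
    retrace {u = u} {u ∷ S} {Q} (south u∈ bi eq q) ⊆P isQ = extendBy (retrace q (⊆P ∘ there) isQ′)
      where
      su∈P = ⊆P (there (InsPath-head∈ q))
      u∈P  = ⊆P (here refl)
      su∈  = ∈P⇒∈λ su∈P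
      at≡ : at λp π (sC u) ≡ at λp π u
      at≡ = trans (at-∈λ π (sC u) su∈) (trans (cong fin (trans (value-∈ (sC u) su∈P)
              (trans (cong suc (fin-injective (trans (sym (at-∈λ σ (sC u) su∈)) (trans (sym eq) (at-∈λ σ u u∈)))))
                (sym (value-∈ u u∈P))))) (sym (at-∈λ π u u∈)))
      isQ′ : IsQ λp π (sC u) (sC u ∷ Q)
      -- Were `s u` in 𝓘 ∪ 𝓐, its east neighbour would be on `P` together with its north neighbour
      -- `u`.
      isQ′ with IA∪OB λp (sC u) su∈
      ... | inj₂ ob = north su∈ ob at≡ isQ
      ... | inj₁ ia = contradiction u∈P (n-e-exclusive (sC u) swP su∈ (proj₁ (proj₁ comp (sC u) su∈P ia)))
      extendBy : (Σ (List Cell) λ R → S ≡ sC u ∷ R × IsQ λp π (endOf q) (reverseAcc (sC u ∷ Q) R)) →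
                 Σ (List Cell) λ R → u ∷ S ≡ u ∷ R × IsQ λp π (endOf q) (reverseAcc Q R)
      extendBy (R , refl , isQ″) = sC u ∷ R , refl , isQ″
    retrace {u = u} {u ∷ S} {Q} (west u∈ _ q) ⊆P isQ = extendBy (retrace q (⊆P ∘ there) isQ′)
      where
      wu∈P = ⊆P (there (InsPath-head∈ q))
      u∈P  = ⊆P (here refl)
      wu∈  = ∈P⇒∈λ wu∈P
      ewu∈P : eC (wC u) ∈ P
      ewu∈P = subst (_∈ P) (sym (eC-wC u u∈)) u∈P
      isQ₀ : IsQ λp π (eC (wC u)) Q
      isQ₀ = subst (λ x → IsQ λp π x Q) (sym (eC-wC u u∈)) isQ
      isQ′ : IsQ λp π (wC u) (wC u ∷ Q)
      isQ′ with IA∪OB λp (wC u) wu∈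
      ... | inj₁ ia = east wu∈ (inj₁ ia) isQ₀
      ... | inj₂ _  = east wu∈ (inj₂ (∈P⇒∈λ ewu∈P ,
                        north-below (wC u) wu∈P (n-e-exclusive (wC u) swP wu∈ ewu∈P))) isQ₀
      extendBy : (Σ (List Cell) λ R → S ≡ wC u ∷ R × IsQ λp π (endOf q) (reverseAcc (wC u ∷ Q) R)) →
                 Σ (List Cell) λ R → u ∷ S ≡ u ∷ R × IsQ λp π (endOf q) (reverseAcc Q R)
      extendBy (R , refl , isQ″) = wC u ∷ R , refl , isQ″

    start-stops : eC ω ∉λ λp → IsQ λp π ω (ω ∷ [])
    start-stops eω∉ = stop ω∈ (north-below ω (InsPath-head∈ p) nω∉P) eω∉
      where
      ω∈ = InsPath-head∈λ p
      ≤ω : ∀ {k u S x} → InsPath λp σ k u S → SWPath λp S → x ∈ S → content x ℤ.≤ content u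
      ≤ω (done _)        sw m = SWPath-≤ sw m
      ≤ω (south _ _ _ _) sw m = SWPath-≤ sw m
      ≤ω (west _ _ _)    sw m = SWPath-≤ sw m
      -- The content of `n ω` exceeds that of ω, the largest on the path.
      nω∉P : nC ω ∉ P
      nω∉P m = ℤₚ.≤⇒≯ (≤ω p swP m) (ℤₚ.suc[i]≤j⇒i<j (ℤₚ.≤-reflexive (sym (content-n ω ω∈))))

    reversed-path-isQ : eC ω ∉λ λp → Σ (List Cell) λ Q → IsQ λp π end Q × σ ≈[ λp ] (π -P Q)
    reversed-path-isQ eω∉ with retrace p (λ m → m) (start-stops eω∉)
    ... | R , refl , isQ = reverse P , isQ , σ≈
      where
      σ≈ : σ ≈[ λp ] (π -P reverse P)
      σ≈ x x∈ with x ∈? P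
      ... | yes x∈P = sym (trans (-P-∈ π (Any.reverse⁺ x∈P)) (cong (_∸ 1) (value-∈ x x∈P)))
      ... | no x∉P  = sym (trans (-P-∉ π (x∉P ∘ Any.reverse⁻)) (value-∉ x x∈ x∉P))

  -- Comparison of two consecutive insertions.

  suffix-of-length : ∀ {σ u P} d k (p : InsPath λp σ (d ℕ.+ k) u P) →
    Σ Cell λ v → Σ (List Cell) λ S → Σ (InsPath λp σ k v S) λ q → (∀ {x} → x ∈ S → x ∈ P) × endOf q ≡ endOf p
  suffix-of-length zero    k p = _ , _ , p , (λ m → m) , refl
  suffix-of-length (suc d) k (south _ _ _ p) with suffix-of-length d k p
  ... | v , S , q , ⊆ , eq = v , S , q , there ∘ ⊆ , eq
  suffix-of-length (suc d) k (west _ _ p) with suffix-of-length d k p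
  ... | v , S , q , ⊆ , eq = v , S , q , there ∘ ⊆ , eq

  -- Where the two paths meet, equal entries of τ along the first path stay equal
  -- in σ = τ + P, so the second path turns south whenever the first one did.
  later-path-stays-south :
    ∀ {τ σ P} → (∀ {x} → x ∈ P → σ x ≡ suc (τ x)) →
    ∀ {k y S x R} (q : InsPath λp τ k y S) (p : InsPath λp σ k x R) → (∀ {z} → z ∈ S → z ∈ P) →
    content x ≡ content y → proj₁ y ℕ.≤ proj₁ x → proj₁ (endOf q) ℕ.≤ proj₁ (endOf p)
  later-path-stays-south v (done _) (done _) _ _ y≤x = y≤x
  later-path-stays-south v {y = y} {x = x} (south _ _ _ q) (south _ _ _ p) ⊆ c≡ y≤x =
    later-path-stays-south v q p (⊆ ∘ there)
      (trans (content-s x) (trans (cong ℤ.pred c≡) (sym (content-s y)))) (s≤s y≤x)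
  later-path-stays-south v {y = y} {x = x} (west y∈ _ q) (south _ _ _ p) ⊆ c≡ y≤x =
    later-path-stays-south v q p (⊆ ∘ there)
      (trans (content-s x) (trans (cong ℤ.pred c≡) (sym (content-w y (proj₁ y∈))))) (ℕₚ.m≤n⇒m≤1+n y≤x)
  later-path-stays-south v {y = y} {x = x} (west y∈ _ q) (west x∈ _ p) ⊆ c≡ y≤x =
    later-path-stays-south v q p (⊆ ∘ there)
      (trans (content-w x (proj₁ x∈)) (trans (cong ℤ.pred c≡) (sym (content-w y (proj₁ y∈))))) y≤x
  -- Only this combination of steps narrows the gap between the rows. A strict gap survives weakly;
  -- without a gap the two cells coincide and the combination is impossible.
  later-path-stays-south {τ} {σ} v {y = y@(i , j)} {x = x@(k , l)} (south y∈ bi eq q) (west x∈ ¬south p) ⊆ c≡ y≤x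
    with ℕₚ.m≤n⇒m<n∨m≡n y≤x
  ... | inj₁ y<x =
    later-path-stays-south v q p (⊆ ∘ there)
      (trans (content-w x (proj₁ x∈)) (trans (cong ℤ.pred c≡) (sym (content-s y)))) y<x
  ... | inj₂ refl with content-row-injective i {l} {j} c≡
  ...   | refl = contradiction (bi , trans (at-∈λ σ y y∈) (trans (cong fin σy≡σsy) (sym (at-∈λ σ (sC y) sy∈)))) ¬south
    where
    sy∈ = InsPath-head∈λ q
    σy≡σsy : σ y ≡ σ (sC y)
    σy≡σsy = trans (v (⊆ (here refl))) (trans
      (cong suc (fin-injective (trans (sym (at-∈λ τ y y∈)) (trans eq (at-∈λ τ (sC y) sy∈)))))
      (sym (v (⊆ (there (InsPath-head∈ q))))))

  pos-∸ : ∀ {m n} → n ℕ.≤ m → + (m ∸ n) ≡ + m ℤ.- + n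
  pos-∸ {m} {n} n≤m = sym (trans (ℤₚ.m-n≡m⊖n m n) (ℤₚ.⊖-≥ n≤m))

  -- The length of a rim-hook is the difference of the contents of its tail and of its head (λ'_j ,
  -- j); the insertion path has the same start and the same length.
  content-hook-end : ∀ {σ P} h → h ∈λ λp → (p : IsInsertionPath λp h σ P) →
                     content (endOf p) ≡ content (col λp (proj₂ h) , proj₂ h)
  content-hook-end (i , j) h∈ p = ∙-cancelˡ ℤₚ.+-0-abelianGroup (+ hookLength λp (i , j)) _ _
    (trans (sym (content-endOf p)) (sym (begin
      + ((c ∸ i) ℕ.+ (r ∸ j)) ℤ.+ (+ j ℤ.- + c)
        ≡⟨ cong (ℤ._+ (+ j ℤ.- + c)) (cong₂ ℤ._+_ (pos-∸ (∈λ⇒≤col λp i j h∈)) (pos-∸ (proj₂ h∈))) ⟩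
      ((+ c ℤ.- + i) ℤ.+ (+ r ℤ.- + j)) ℤ.+ (+ j ℤ.- + c)
        ≡⟨ telescope (+ c) (+ i) (+ r) (+ j) ⟩
      + r ℤ.- + i ∎)))
    where
    open ≡-Reasoning
    c = col λp j
    r = row λp i
    telescope : ∀ c i r j → ((c ℤ.- i) ℤ.+ (r ℤ.- j)) ℤ.+ (j ℤ.- c) ≡ r ℤ.- i
    telescope = solve-∀

  -- The path ends on the diagonal of the bottom cell of a column, a rim cell without southern
  -- neighbour.
  hook-end-OA : ∀ {σ P} h → h ∈λ λp → (p : IsInsertionPath λp h σ P) → inOA λp (endOf p)
  hook-end-OA (i , j) h∈ p = bottom⇒inOA λp (col λp j) j (endOf p) (column-bottom λp i j h∈) (below-column λp i j h∈)
    (SWPath-∈λ (InsPath⇒SWPath p) (endOf∈ p)) (content-hook-end (i , j) h∈ p)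

  -- A hook starting in a column further east has a head of larger content. Within one column the
  -- contents agree, and the longer path of `h′` is cut down to the diagonals that both paths share.
  ends-antitone : ∀ {τ σ P R} h h′ → h ∈λ λp → h′ ∈λ λp → h ≤rl h′ →
    (q : IsInsertionPath λp h′ τ P) → (∀ {x} → x ∈ P → σ x ≡ suc (τ x)) →
    (p : IsInsertionPath λp h σ R) → endOf p ⊴ endOf q
  ends-antitone (i , j) (i′ , j′) h∈ h′∈ (inj₁ j>j′) q v p = inj₁ (subst₂ ℤ._<_
    (sym (content-hook-end (i′ , j′) h′∈ q)) (sym (content-hook-end (i , j) h∈ p))
    (ℤₚ.+-mono-<-≤ (ℤ.+<+ j>j′) (ℤₚ.neg-mono-≤ (ℤ.+≤+ (col-antitone λp i j j′ h∈ (proj₁ h′∈) (ℕₚ.<⇒≤ j>j′))))))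
  ends-antitone {τ} {P = P} (i , j) (i′ , .j) h∈ h′∈ (inj₂ (refl , i≥i′)) q v p = inj₂ (c≡ , row≤)
    where
    c≡ : content (endOf p) ≡ content (endOf q)
    c≡ = trans (content-hook-end (i , j) h∈ p) (sym (content-hook-end (i′ , j) h′∈ q))
    k  = hookLength λp (i , j)
    k′ = hookLength λp (i′ , j)
    k≤k′ : k ℕ.≤ k′
    k≤k′ = ℕₚ.+-mono-≤ (ℕₚ.∸-monoʳ-≤ (col λp j) i≥i′)
                       (ℕₚ.∸-monoˡ-≤ j (row-antitone λp (∈λ-row λp i′ h′∈) i≥i′))
    row≤ : proj₁ (endOf q) ℕ.≤ proj₁ (endOf p)
    row≤ = go q {k′ ∸ k} (sym (ℕₚ.m∸n+n≡m k≤k′)) c≡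
      where
      -- The length is generalised to `n` so that it can be matched with `d ℕ.+ k`.
      go : ∀ {n} (q : InsPath λp τ n (hookTail λp (i′ , j)) P) {d} → n ≡ d ℕ.+ k → content (endOf p) ≡ content (endOf q) →
           proj₁ (endOf q) ℕ.≤ proj₁ (endOf p)
      go q {d} refl c≡ with suffix-of-length d k q
      ... | (a , b) , S , q′ , ⊆ , eq =
        subst (λ z → proj₁ z ℕ.≤ proj₁ (endOf p)) eq (later-path-stays-south v q′ p ⊆ start≡ a≤i)
        where
        start≡ : content (i , row λp i) ≡ content (a , b)
        start≡ = trans (content-endOf p)
          (trans (cong (ℤ._+_ (+ k)) (trans c≡ (cong content (sym eq)))) (sym (content-endOf q′)))
        -- Row `i` is at least as long as any lower row, so every cell below row `i` has smaller
        -- content than the end of row `i`.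
        a≤i : a ℕ.≤ i
        a≤i = ℕₚ.≮⇒≥ λ i<a → ℤₚ.<-irrefl (sym start≡) (content-mono-<
          (ℕₚ.≤-trans (proj₂ (InsPath-head∈λ q′)) (row-antitone λp (∈λ-row λp i h∈) (ℕₚ.<⇒≤ i<a))) i<a)

  -- Minimality of the head among all candidates.

  0≤at : ∀ π u → fin 0 ≤∞ at λp π u
  0≤at π (zero  , j)     = fin≤fin z≤n
  0≤at π (suc i , zero)  = fin≤fin z≤n
  0≤at π (suc i , suc j) with suc j ℕ.≤? row λp (suc i)
  ... | yes _ = fin≤fin z≤n
  ... | no _  = fin 0 ≤∞∞

  zero-rpp : IsRPP λp zeroF
  zero-rpp u u∈ rewrite at-∈λ zeroF u u∈ = 0≤at zeroF (eC u) , 0≤at zeroF (sC u)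

  zero-no-cand : ∀ {σ} → σ ≈[ λp ] zeroF → ∀ u → ¬ Cand λp σ u
  zero-no-cand {σ} σ≈0 u c = not-below (below c)
    where
    below : Cand λp σ u → u ∈λ λp × at λp σ (wC u) <∞ at λp σ u
    below (inj₁ ((u∈ , _) , w<))     = u∈ , w<
    below (inj₂ ((u∈ , _) , w< , _)) = u∈ , w<
    not-below : ¬ (u ∈λ λp × at λp σ (wC u) <∞ at λp σ u)
    not-below (u∈ , w<) rewrite at-∈λ σ u u∈ | σ≈0 u u∈ with at λp σ (wC u) | w<
    ... | fin _ | fin<fin ()

  HookFact-rpp : ∀ {hs σ} → HookFact λp hs σ → IsRPP λp σ
  HookFact-rpp (nil σ≈0)            = IsRPP-cong σ≈0 zero-rpp
  HookFact-rpp (cons _ _ ins p π≈) = IsRPP-cong π≈ (proj₂ (inserts⇒compatible ins p))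

  firstEnd : ∀ {h hs π} → HookFact λp (h ∷ hs) π → Cell
  firstEnd (cons _ _ _ p _) = endOf p

  ⊴-refl : ∀ {u} → u ⊴ u
  ⊴-refl = inj₂ (refl , ℕₚ.≤-refl)

  ⊴-trans : ∀ {u v w} → u ⊴ v → v ⊴ w → u ⊴ w
  ⊴-trans         (inj₁ v<u)       (inj₁ w<v)       = inj₁ (ℤₚ.<-trans w<v v<u)
  ⊴-trans {u}     (inj₁ v<u)       (inj₂ (v≡w , _)) = inj₁ (subst (ℤ._< content u) v≡w v<u)
  ⊴-trans {w = w} (inj₂ (u≡v , _)) (inj₁ w<v)       = inj₁ (subst (content w ℤ.<_) (sym u≡v) w<v)
  ⊴-trans         (inj₂ (u≡v , r)) (inj₂ (v≡w , s)) = inj₂ (trans u≡v v≡w , ℕₚ.≤-trans s r)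

  firstEnd-minCand : ∀ {h hs π} (f : HookFact λp (h ∷ hs) π) → Linked _≤rl_ (h ∷ hs) → IsMinCand λp π (firstEnd f)
  firstEnd-minCand {h} {hs} {π} (cons {σ = σ} h∈ f ins p π≈) lex = end-cand (hook-end-OA h h∈ p) , minimal
    where
    open Insertion p (proj₁ (inserts⇒compatible ins p)) (HookFact-rpp f) π≈
    σ-minimal : ∀ {hs} → Linked _≤rl_ (h ∷ hs) → HookFact λp hs σ → ∀ u → Cand λp σ u → end ⊴ u
    σ-minimal _         (nil σ≈0) u c = contradiction c (zero-no-cand σ≈0 u)
    -- By induction the head of the path of `h′` precedes all candidates of σ, and the order of the
    -- two hooks puts `end` before that head.
    σ-minimal (h≤ ∷ lex) f′@(cons {h = h′} h′∈ g ins′ q σ≈) u c =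
      ⊴-trans {end} {endOf q} {u}
        (ends-antitone h h′ h∈ h′∈ h≤ q
          (Insertion.value-∈ q (proj₁ (inserts⇒compatible ins′ q)) (HookFact-rpp g) σ≈ _) p)
        (proj₂ (firstEnd-minCand f′ lex) u c)
    minimal : ∀ u → Cand λp π u → end ⊴ u
    minimal u c with cand⇒end-or-cand u c
    ... | inj₁ refl = ⊴-refl {u}
    ... | inj₂ c′   = σ-minimal lex f u c′

mainTheorem16 : (λp : Partition) (π : Filling) → IsRPP λp π →
    (h : Cell) (hs : List Cell) →
    LexFact λp (h ∷ hs) π →
    (σ : Filling) → HookFact λp hs σ → (P : List Cell) → IsInsertionPath λp h σ P →
    π ≈[ λp ] (σ +P P) →
    Σ Cell (λ v → IsMinCand λp π v × Σ (List Cell) (λ Q → IsQ λp π v Q × σ ≈[ λp ] (π -P Q)))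
mainTheorem16 λp π _ h hs (f@(cons h∈ g ins p π≈) , lex) σ g′ _ _ _
  with Insertion.reversed-path-isQ λp p (proj₁ (inserts⇒compatible λp ins p)) (HookFact-rpp λp g) π≈
         -- ω is the last cell of its row, so `e ω` would exceed the row length.
         (λ eω∈ → ℕₚ.<-irrefl refl (proj₂ eω∈))
... | Q , isQ , σ′≈ =
  firstEnd λp f , firstEnd-minCand λp f lex , Q , isQ ,
  λ u u∈ → trans (HookFact-functional λp g′ g u u∈) (σ′≈ u u∈)
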